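{- Let $a_0,a_1,a_2,b_0,b_1,b_2,q$ be indeterminates and put $\mathbf{x}=(a_0,a_1,a_2,b_0,b_1,b_2,q)$. Let $[T_{n,k}]_{n,k\ge0}$ be a triangular array with $T_{0,0}=1$ and $T_{n,k}=0$ unless $0\le k\le n$, which satisfies, for all $n\ge1$ and all $k$, any one of the following recurrences: (i) $T_{n,k}=[a_0(n-1)+a_2]T_{n-1,k}+[b_0(n-1)+b_2]T_{n-1,k-1}$; (ii) $T_{n,k}=[a_0(b_0+b_1)(n-1)+a_0b_1k+a_0b_2]T_{n-1,k}+[b_0(n-1)+b_1(k-1)+b_2]T_{n-1,k-1}$; (iii) $T_{n,k}=(a_1k+a_2)T_{n-1,k}+[b_1(k-1)+b_2]T_{n-1,k-1}$; (iv) $T_{n,k}=[a_0(n-k-1)+a_2]T_{n-1,k}+[b_0(n-k)+b_2]T_{n-1,k-1}$; (v) $T_{n,k}=(a_1k+a_2)T_{n-1,k}+(b_0n-b_0k+b_2)T_{n-1,k-1}$, where $0\in\{a_2,\,b_2,\,a_1-a_2,\,b_0-b_2\}$; (vi) $T_{n,k}=b_0\left(n-2k+\frac{2a_2-a_1}{a_1}\right)T_{n-1,k}+[a_1(n-k)+a_2]T_{n-1,k-1}$; (vii) $T_{n,k}=(a_1k+a_2)T_{n-1,k}+b_0\left(2k-n+\frac{2a_2-a_1}{a_1}\right)T_{n-1,k-1}$. Let $T_n(q)=\sum_{k\ge0}T_{n,k}q^k$. Then $(T_n(q))_{n\ge0}$ is an $\mathbf{x}$-Stieltjes moment sequence and a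 $3$-$\mathbf{x}$-log-convex sequence.
   Context: For a set of indeterminates $\mathbf{x}$, write $f\ge_{\mathbf{x}}0$ if $f$ is a polynomial in $\mathbf{x}$ with nonnegative coefficients. A matrix is $\mathbf{x}$-totally positive ($\mathbf{x}$-TP) if all its minors are $\ge_{\mathbf{x}}0$, and $\mathbf{x}$-TP$_r$ if all its minors of order $\le r$ are $\ge_{\mathbf{x}}0$. A sequence $(\alpha_n)_{n\ge0}$ is an $\mathbf{x}$-Stieltjes moment ($\mathbf{x}$-SM) sequence if its Hankel matrix $[\alpha_{i+j}]_{i,j\ge0}$ is $\mathbf{x}$-TP. Define $\mathcal{L}[\alpha_i]=\alpha_{i-1}\alpha_{i+1}-\alpha_i^2$ for $i\ge1$ and $\mathcal{L}^m=\mathcal{L}(\mathcal{L}^{m-1})$; the sequence is $k$-$\mathbf{x}$-log-convex if $\mathcal{L}^m[\alpha_i]\ge_{\mathbf{x}}0$ for all $m\le k$ and all $i$ for which it is defined.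
   Formalization: In (vi) and (vii), T_n(q) is not a polynomial in x (in (vi), T_1(q) = 2a_2b_0/a_1 + a_2q), so "≥_x 0" is read as nonnegative coefficients with negative powers of a_1 allowed; in (i)–(v) no such powers occur and the notion is the ordinary one. -}

module Defs where

open import Data.Nat as ℕ using (ℕ; zero; suc)
open import Data.Integer as ℤ using (ℤ; +_; 0ℤ; 1ℤ; -1ℤ)
open import Data.Fin as Fin using (Fin; zero; suc)
open import Data.Vec as Vec using (Vec; tabulate; zipWith; lookup)
open import Data.Vec.Properties using (≡-dec)
open import Data.List as List using (List; []; _∷_; [_]; _++_; map; concatMap; foldr; upTo; allFin)
open import Data.Product using (_×_; _,_)
open import Data.Sum using (_⊎_)
open import Data.Bool using (if_then_else_)
open import Relation.Nullary using (¬_; yes; no)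
open import Relation.Nullary.Decidable using (⌊_⌋)
open import Relation.Binary.PropositionalEquality using (_≡_)

-- The ring ℤ[a₀^{±1},a₁^{±1},a₂^{±1},b₀^{±1},b₁^{±1},b₂^{±1},q^{±1}]
-- of integer Laurent polynomials in the seven indeterminates
--   x = (a₀, a₁, a₂, b₀, b₁, b₂, q)   (variable indices 0,…,6).
-- A monomial is its exponent vector; a polynomial is a finite list of
-- (coefficient, monomial) terms, identified up to equality of the
-- coefficient function `coeff` (so the representation is not normalised).

Mon : Set
Mon = Vec ℤ 7

_≟ₘ_ : (m m' : Mon) → _
_≟ₘ_ = ≡-dec ℤ._≟_

Poly : Set
Poly = List (ℤ × Mon)

coeff : Poly → Mon → ℤ
coeff [] m = 0ℤ
coeff ((c , m') ∷ p) m with m' ≟ₘ m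
... | yes _ = c ℤ.+ coeff p m
... | no  _ = coeff p m

infix 4 _≈_
_≈_ : Poly → Poly → Set
p ≈ r = ∀ m → coeff p m ≡ coeff r m

zeroMon : Mon
zeroMon = tabulate (λ _ → 0ℤ)

𝟘 : Poly
𝟘 = []

ι : ℤ → Poly
ι c = [ (c , zeroMon) ]

𝟙 : Poly
𝟙 = ι 1ℤ

infixl 6 _⊕_
infixl 7 _⊗_

_⊕_ : Poly → Poly → Poly
_⊕_ = _++_

neg : Poly → Poly
neg = map (λ { (c , m) → (ℤ.- c , m) })

_⊗_ : Poly → Poly → Poly
p ⊗ r = concatMap (λ { (c , m) → map (λ { (d , n) → (c ℤ.* d , zipWith ℤ._+_ m n) }) r }) p

_^ᵖ_ : Poly → ℕ → Poly
p ^ᵖ zero = 𝟙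
p ^ᵖ suc n = p ⊗ (p ^ᵖ n)

sumᵖ : List Poly → Poly
sumᵖ = foldr _⊕_ 𝟘

X : Fin 7 → Poly
X i = [ (1ℤ , tabulate (λ j → if ⌊ i Fin.≟ j ⌋ then 1ℤ else 0ℤ)) ]

a₀ a₁ a₂ b₀ b₁ b₂ q : Poly
a₀ = X zero
a₁ = X (suc zero)
a₂ = X (suc (suc zero))
b₀ = X (suc (suc (suc zero)))
b₁ = X (suc (suc (suc (suc zero))))
b₂ = X (suc (suc (suc (suc (suc zero)))))
q  = X (suc (suc (suc (suc (suc (suc zero))))))

a₁⁻¹ : Poly
a₁⁻¹ = [ (1ℤ , tabulate (λ j → if ⌊ suc zero Fin.≟ j ⌋ then -1ℤ else 0ℤ)) ]

-- f ≥ₓ 0 : f has nonnegative coefficients and is a polynomial in x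
-- (no negative exponents), except that negative powers of a₁ are
-- allowed (a₁ appears as a denominator in recurrences (vi),(vii)).

NonNeg : Poly → Set
NonNeg f = (∀ m → 0ℤ ℤ.≤ coeff f m)
         × (∀ m → ¬ (coeff f m ≡ 0ℤ) → ∀ (i : Fin 7) → ¬ (i ≡ suc zero) → 0ℤ ℤ.≤ lookup m i)

sign : ℕ → ℤ
sign zero = 1ℤ
sign (suc n) = ℤ.- sign n

det : (r : ℕ) → (Fin r → Fin r → Poly) → Poly
det zero M = 𝟙
det (suc r) M =
  sumᵖ (map (λ j → ι (sign (Fin.toℕ j)) ⊗ M zero j
                   ⊗ det r (λ i k → M (suc i) (Fin.punchIn j k)))
            (allFin (suc r)))

StrictlyIncreasing : {r : ℕ} → (Fin r → ℕ) → Set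
StrictlyIncreasing f = ∀ i j → i Fin.< j → f i ℕ.< f j

TP : (ℕ → ℕ → Poly) → Set
TP H = ∀ (r : ℕ) (rows cols : Fin r → ℕ) →
       StrictlyIncreasing rows → StrictlyIncreasing cols →
       NonNeg (det r (λ i j → H (rows i) (cols j)))

StieltjesMoment : (ℕ → Poly) → Set
StieltjesMoment α = TP (λ i j → α (i ℕ.+ j))

-- The operator 𝓛.  (𝓛 α) j represents 𝓛[α_{j+1}] (shifted so that the
-- index starts at 0); hence (𝓛ⁿ m α) j is 𝓛^m[α_{j+m}], and j ranges
-- over exactly the indices where 𝓛^m is defined.

𝓛 : (ℕ → Poly) → ℕ → Poly
𝓛 α j = α j ⊗ α (suc (suc j)) ⊕ neg (α (suc j) ⊗ α (suc j))

𝓛ⁿ : ℕ → (ℕ → Poly) → ℕ → Poly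
𝓛ⁿ zero α = α
𝓛ⁿ (suc m) α = 𝓛 (𝓛ⁿ m α)

LogConvex : ℕ → (ℕ → Poly) → Set
LogConvex k α = ∀ m → 1 ℕ.≤ m → m ℕ.≤ k → ∀ j → NonNeg (𝓛ⁿ m α j)

-- T_{0,0} = 1 and T_{n,k} = 0 for k > n (negative k is not represented;
-- T_{n,-1} is read as 0 in the recurrences).
Triangular : (ℕ → ℕ → Poly) → Set
Triangular T = (T 0 0 ≈ 𝟙) × (∀ n k → n ℕ.< k → T n k ≈ 𝟘)

Recurrence : (ℕ → ℕ → Poly) → (ℕ → ℕ → Poly) → (ℕ → ℕ → Poly) → Set
Recurrence A B T = ∀ n →
    (T (suc n) zero ≈ A (suc n) zero ⊗ T n zero)
  × (∀ k → T (suc n) (suc k) ≈ A (suc n) (suc k) ⊗ T n (suc k) ⊕ B (suc n) (suc k) ⊗ T n k)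

ν : ℕ → ℤ
ν n = + n

Aᵢ Bᵢ : ℕ → ℕ → Poly
Aᵢ n k = a₀ ⊗ ι (ν n ℤ.- 1ℤ) ⊕ a₂
Bᵢ n k = b₀ ⊗ ι (ν n ℤ.- 1ℤ) ⊕ b₂

Aᵢᵢ Bᵢᵢ : ℕ → ℕ → Poly
Aᵢᵢ n k = a₀ ⊗ (b₀ ⊕ b₁) ⊗ ι (ν n ℤ.- 1ℤ) ⊕ a₀ ⊗ b₁ ⊗ ι (ν k) ⊕ a₀ ⊗ b₂
Bᵢᵢ n k = b₀ ⊗ ι (ν n ℤ.- 1ℤ) ⊕ b₁ ⊗ ι (ν k ℤ.- 1ℤ) ⊕ b₂

Aᵢᵢᵢ Bᵢᵢᵢ : ℕ → ℕ → Poly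
Aᵢᵢᵢ n k = a₁ ⊗ ι (ν k) ⊕ a₂
Bᵢᵢᵢ n k = b₁ ⊗ ι (ν k ℤ.- 1ℤ) ⊕ b₂

Aᵢᵥ Bᵢᵥ : ℕ → ℕ → Poly
Aᵢᵥ n k = a₀ ⊗ ι (ν n ℤ.- ν k ℤ.- 1ℤ) ⊕ a₂
Bᵢᵥ n k = b₀ ⊗ ι (ν n ℤ.- ν k) ⊕ b₂

-- (v), with a₂ and b₂ replaced by α and β (to encode the side condition
-- 0 ∈ {a₂, b₂, a₁ - a₂, b₀ - b₂} by specialisation)
Aᵥ Bᵥ : Poly → ℕ → ℕ → Poly
Aᵥ α n k = a₁ ⊗ ι (ν k) ⊕ α
Bᵥ β n k = b₀ ⊗ ι (ν n) ⊕ neg (b₀ ⊗ ι (ν k)) ⊕ β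

Aᵥᵢ Bᵥᵢ : ℕ → ℕ → Poly
Aᵥᵢ n k = b₀ ⊗ (ι (ν n ℤ.- + 2 ℤ.* ν k) ⊕ (ι (+ 2) ⊗ a₂ ⊕ neg a₁) ⊗ a₁⁻¹)
Bᵥᵢ n k = a₁ ⊗ ι (ν n ℤ.- ν k) ⊕ a₂

Aᵥᵢᵢ Bᵥᵢᵢ : ℕ → ℕ → Poly
Aᵥᵢᵢ n k = a₁ ⊗ ι (ν k) ⊕ a₂
Bᵥᵢᵢ n k = b₀ ⊗ (ι (+ 2 ℤ.* ν k ℤ.- ν n) ⊕ (ι (+ 2) ⊗ a₂ ⊕ neg a₁) ⊗ a₁⁻¹)

-- T satisfies one of the recurrences (i)–(vii); for (v) the four ways
-- to meet the side condition: a₂ = 0, b₂ = 0, a₂ = a₁, b₂ = b₀.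
OneOfRecurrences : (ℕ → ℕ → Poly) → Set
OneOfRecurrences T =
    Recurrence Aᵢ Bᵢ T
  ⊎ Recurrence Aᵢᵢ Bᵢᵢ T
  ⊎ Recurrence Aᵢᵢᵢ Bᵢᵢᵢ T
  ⊎ Recurrence Aᵢᵥ Bᵢᵥ T
  ⊎ Recurrence (Aᵥ 𝟘) (Bᵥ b₂) T
  ⊎ Recurrence (Aᵥ a₂) (Bᵥ 𝟘) T
  ⊎ Recurrence (Aᵥ a₁) (Bᵥ b₂) T
  ⊎ Recurrence (Aᵥ a₂) (Bᵥ b₀) T
  ⊎ Recurrence Aᵥᵢ Bᵥᵢ T
  ⊎ Recurrence Aᵥᵢᵢ Bᵥᵢᵢ T

rowPoly : (ℕ → ℕ → Poly) → ℕ → Poly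
rowPoly T n = sumᵖ (map (λ k → T n k ⊗ (q ^ᵖ k)) (upTo (suc n)))

{-# OPTIONS --safe #-}

-- Homogenised by a second variable p, each recurrence reads T_{n+1} = s T_n + ξ T_n with s linear
-- and ξ a derivation that raises the degree by one; on polynomials of degree n in q it becomes
-- ξ = κ θ + n η with θ = q d/dq.  In all cases there is a linear u such that the triangle L with
-- L_{n,0} = T_n and ξ L_{n,k} = u (L_{n,k+1} + k L_{n,k}) has a tridiagonal production matrix J with
-- diagonal s + k ω, constant superdiagonal u and quadratic subdiagonal, so T_n = (J^n)_{0,0}.
-- Up to a positive integer, J is a product of two nonnegative bidiagonal matrices plus a nonnegative
-- diagonal matrix.  Hence both factors of [T_{i+j}] = L R, where L has the rows (J^i)_{0,·} and R the
-- columns (J^j)_{·,0}, are built by steps that replace the columns of a matrix by nonnegative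
-- combinations of columns in successive intervals, and such steps preserve total positivity.
-- By Dodgson condensation the first three iterates of 𝓛 are polynomials with nonnegative
-- coefficients in minors of the Hankel matrix.
module Submission where

open import Algebra.Bundles using (CommutativeRing; RawRing)
open import Algebra.Solver.Ring.AlmostCommutativeRing using (fromCommutativeRing; _-Raw-AlmostCommutative⟶_)
open import Data.Bool using (Bool; true; false; if_then_else_)
open import Data.Empty using (⊥)
open import Data.Fin as Fin using (Fin; zero; suc)
open import Data.Fin.Patterns
open import Data.Integer as ℤ using (ℤ; +_; -[1+_]; 0ℤ; 1ℤ)
import Data.Integer.Properties as ℤ
open import Data.Integer.Tactic.RingSolver using (solve-∀)
open import Data.List using (List; []; _∷_; _++_; [_]; map; replicate; tabulate; applyUpTo)
open import Data.List.Properties using (++-assoc; ++-identityʳ; map-++; map-∘; map-cong; map-id; map-tabulate)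
open import Data.List.Relation.Unary.All using (All; []; _∷_)
open import Data.List.Relation.Unary.All.Properties using (++⁺)
open import Data.Maybe using (Maybe; just; nothing)
open import Data.Nat as ℕ using (ℕ; zero; suc; _≤_; _<_; z≤n; s≤s; ⌊_/2⌋)
import Data.Nat.Properties as ℕ
open import Data.Product using (_×_; _,_; ∃; ∃₂; proj₁; proj₂)
open import Data.Sum using (_⊎_; inj₁; inj₂)
open import Data.Unit using (⊤)
open import Data.Vec as Vec using (Vec; []; _∷_; lookup; zipWith)
open import Data.Vec.Properties using (lookup∘tabulate; lookup-zipWith; zipWith-assoc; zipWith-comm; zipWith-identityˡ)
open import Function using (_∘_; id)
open import Level using (0ℓ; _⊔_)
open import Relation.Binary.PropositionalEquality as ≡ using (_≡_)
open import Relation.Nullary using (¬_; yes; no; contradiction)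
open import Relation.Nullary.Decidable using (⌊_⌋)
open import Relation.Unary using (Pred)

-- What limits the method is the choice of u: it has to divide both ξ u and ξ s. In case (v) the
-- homogenised derivation has ξ p = b₀ p q and ξ q = a₁ p q. The nonnegative linear forms dividing
-- their own image are therefore the multiples of p and of q, while ξ s = (a₂ b₀ + a₁ b₂) p q. The
-- condition ξ γ = u γ then leaves u = a₁ p with γ = (b₂ + a₂ b₀ / a₁) q, or u = b₀ q with γ = (a₂ +
-- a₁ b₂ / b₀) p. The side condition lists the values of a₂ and b₂ at which one of these quotients
-- has no denominator. The positive integer is 2 and is needed only for (vi) and (vii). There the
-- second difference of the subdiagonal is not twice an integral form, so its two linear factors in
-- k become integral only after doubling. Hence nonnegativity is required to survive the
-- cancellation of 2. The added diagonal matrix is a real obstacle, because a sum of totally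
-- positive matrices need not be totally positive. It is handled by interleaving the original
-- columns with those of the first bidiagonal product.

-- A ring solver with integer constants over an arbitrary commutative ring.

module IntegerSolver {c ℓ} (R : CommutativeRing c ℓ) where

  open CommutativeRing R
  open import Algebra.Properties.Ring ring
  open import Algebra.Properties.AbelianGroup +-abelianGroup
  open import Algebra.Properties.CommutativeSemigroup +-commutativeSemigroup
  open import Algebra.Properties.Semiring.Mult.TCOptimised semiring
    renaming (_×_ to _·_; 1+× to 1+·; ×-homo-+ to ·-homo-+)
  open import Relation.Binary.Reasoning.Setoid setoid

  -- In this variant of multiples `1 · x` reduces to `x`. Hence `con 1ℤ` evaluates to `1#` and
  -- `con (+ 2)` to `1# + 1#` by computation alone, which `1-homo` and the uses of `1-cancel` and
  -- `2-cancel` rely on.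
  fromℤ : ℤ → Carrier
  fromℤ (+ n)    = n · 1#
  fromℤ -[1+ n ] = - (suc n · 1#)

  fromℤ-⊖ : ∀ m n → fromℤ (m ℤ.⊖ n) ≈ m · 1# + - (n · 1#)
  fromℤ-⊖ zero    zero    = sym (-‿inverseʳ 0#)
  fromℤ-⊖ zero    (suc n) = sym (+-identityˡ _)
  fromℤ-⊖ (suc m) zero    = sym (trans (+-congˡ ε⁻¹≈ε) (+-identityʳ _))
  fromℤ-⊖ (suc m) (suc n) = begin
    fromℤ (suc m ℤ.⊖ suc n)                      ≡⟨ ≡.cong fromℤ (ℤ.[1+m]⊖[1+n]≡m⊖n m n) ⟩
    fromℤ (m ℤ.⊖ n)                              ≈⟨ fromℤ-⊖ m n ⟩
    m · 1# + - (n · 1#)                          ≈⟨ +-identityˡ _ ⟨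
    0# + (m · 1# + - (n · 1#))                   ≈⟨ +-congʳ (-‿inverseʳ 1#) ⟨
    (1# + - 1#) + (m · 1# + - (n · 1#))          ≈⟨ interchange _ _ _ _ ⟩
    (1# + m · 1#) + (- 1# + - (n · 1#))          ≈⟨ +-cong (sym (1+· m 1#)) (⁻¹-∙-comm _ _) ⟩
    suc m · 1# + - (1# + n · 1#)                 ≈⟨ +-congˡ (-‿cong (1+· n 1#)) ⟨
    suc m · 1# + - (suc n · 1#)                  ∎

  fromℤ-+ : ∀ i j → fromℤ (i ℤ.+ j) ≈ fromℤ i + fromℤ j
  fromℤ-+ (+ m)    (+ n)    = ·-homo-+ 1# m n
  fromℤ-+ (+ m)    -[1+ n ] = fromℤ-⊖ m (suc n)
  fromℤ-+ -[1+ m ] (+ n)    = trans (fromℤ-⊖ n (suc m)) (+-comm _ _)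
  fromℤ-+ -[1+ m ] -[1+ n ] = begin
    - (suc (suc (m ℕ.+ n)) · 1#)            ≡⟨ ≡.cong (λ k → - (suc k · 1#)) (ℕ.+-suc m n) ⟨
    - ((suc m ℕ.+ suc n) · 1#)              ≈⟨ -‿cong (·-homo-+ 1# (suc m) (suc n)) ⟩
    - (suc m · 1# + suc n · 1#)             ≈⟨ ⁻¹-∙-comm _ _ ⟨
    - (suc m · 1#) + - (suc n · 1#)         ∎

  fromℤ-neg : ∀ i → fromℤ (ℤ.- i) ≈ - fromℤ i
  fromℤ-neg (+ zero)  = sym ε⁻¹≈ε
  fromℤ-neg (+ suc n) = refl
  fromℤ-neg -[1+ n ]  = sym (⁻¹-involutive _)

  fromℤ-*⁺ : ∀ m j → fromℤ (+ m ℤ.* j) ≈ m · 1# * fromℤ j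
  fromℤ-*⁺ zero j = begin
    fromℤ (+ 0 ℤ.* j)   ≡⟨ ≡.cong fromℤ (ℤ.*-zeroˡ j) ⟩
    0#                  ≈⟨ zeroˡ _ ⟨
    0# * fromℤ j        ∎
  fromℤ-*⁺ (suc m) j = begin
    fromℤ (+ suc m ℤ.* j)               ≡⟨ ≡.cong fromℤ (ℤ.suc-* (+ m) j) ⟩
    fromℤ (j ℤ.+ + m ℤ.* j)             ≈⟨ fromℤ-+ j (+ m ℤ.* j) ⟩
    fromℤ j + fromℤ (+ m ℤ.* j)         ≈⟨ +-cong (sym (*-identityˡ _)) (fromℤ-*⁺ m j) ⟩
    1# * fromℤ j + m · 1# * fromℤ j     ≈⟨ distribʳ _ _ _ ⟨
    (1# + m · 1#) * fromℤ j             ≈⟨ *-congʳ (1+· m 1#) ⟨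
    suc m · 1# * fromℤ j                ∎

  fromℤ-* : ∀ i j → fromℤ (i ℤ.* j) ≈ fromℤ i * fromℤ j
  fromℤ-* (+ m)    j = fromℤ-*⁺ m j
  fromℤ-* -[1+ m ] j = begin
    fromℤ (-[1+ m ] ℤ.* j)           ≡⟨ ≡.cong fromℤ (ℤ.neg-distribˡ-* (+ suc m) j) ⟨
    fromℤ (ℤ.- (+ suc m ℤ.* j))      ≈⟨ fromℤ-neg (+ suc m ℤ.* j) ⟩
    - fromℤ (+ suc m ℤ.* j)          ≈⟨ -‿cong (fromℤ-*⁺ (suc m) j) ⟩
    - (suc m · 1# * fromℤ j)         ≈⟨ -‿distribˡ-* _ _ ⟩
    - (suc m · 1#) * fromℤ j         ∎

  private
    ℤ-rawRing : RawRing _ _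
    ℤ-rawRing = CommutativeRing.rawRing ℤ.+-*-commutativeRing

    morphism : ℤ-rawRing -Raw-AlmostCommutative⟶ fromCommutativeRing R
    morphism = record
      { ⟦_⟧    = fromℤ
      ; +-homo = fromℤ-+
      ; *-homo = fromℤ-*
      ; -‿homo = fromℤ-neg
      ; 0-homo = refl
      ; 1-homo = refl
      }

    coeff≟ : ∀ i j → Maybe (fromℤ i ≈ fromℤ j)
    coeff≟ i j with i ℤ.≟ j
    ... | yes ≡.refl = just refl
    ... | no _       = nothing

  open import Algebra.Solver.Ring ℤ-rawRing (fromCommutativeRing R) morphism coeff≟ public
    using (Polynomial; Op; op; [+]; [*]; con; var; _:^_; _:+_; _:*_; :-_; _:=_; ⟦_⟧; ⟦_⟧↓; solve; prove)

-- Alternating multilinear forms on lists of columns, and minors.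

module AlternatingForm {c ℓ} (R : CommutativeRing c ℓ) where

  open CommutativeRing R
  open IntegerSolver R
  open import Relation.Binary.Reasoning.Setoid setoid

  Column : Set c
  Column = ℕ → Carrier

  infix 4 _≗_
  _≗_ : Column → Column → Set ℓ
  f ≗ g = ∀ i → f i ≈ g i

  Combination : Carrier → Carrier → Column → Column → Column → Set ℓ
  Combination a b f g h = ∀ i → f i ≈ a * g i + b * h i

  Multilinear : (List Column → Carrier) → Set (c ⊔ ℓ)
  Multilinear F = ∀ {a b f g h} → Combination a b f g h → ∀ pre post →
    F (pre ++ f ∷ post) ≈ a * F (pre ++ g ∷ post) + b * F (pre ++ h ∷ post)

  -- Neighbouring repetitions suffice: the column lists that arise are weakly increasing in their
  -- indices, and there equal indices can be found side by side.
  Alternating : (List Column → Carrier) → Set (c ⊔ ℓ)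
  Alternating F = ∀ f pre post → F (pre ++ f ∷ f ∷ post) ≈ 0#

  record IsForm (F : List Column → Carrier) : Set (c ⊔ ℓ) where
    field
      multilinear : Multilinear F
      alternating : Alternating F

  open IsForm

  -- Freezing the leading column yields another form, so inductions along a column list can
  -- generalise over the form instead of carrying a prefix.
  contract : Column → (List Column → Carrier) → List Column → Carrier
  contract f F = F ∘ (f ∷_)

  contract-isForm : ∀ f {F} → IsForm F → IsForm (contract f F)
  contract-isForm f form = record
    { multilinear = λ comb pre post → multilinear form comb (f ∷ pre) post
    ; alternating = λ g pre post → alternating form g (f ∷ pre) post
    }

  form-cong : ∀ {F} → IsForm F → ∀ {f g} → f ≗ g → ∀ pre post →
                     F (pre ++ f ∷ post) ≈ F (pre ++ g ∷ post)
  form-cong form {f} {g} f≗g pre post = trans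
    (multilinear form {1#} {0#} {f} {g} {g} (λ i → trans (f≗g i) (solve 1 (λ x → x := con 1ℤ :* x :+ con 0ℤ :* x) refl (g i))) pre post)
    (solve 1 (λ x → con 1ℤ :* x :+ con 0ℤ :* x := x) refl _)

  form-map-cong : ∀ {F} → IsForm F → ∀ {V W : ℕ → Column} → (∀ k → V k ≗ W k) →
                  ∀ js → F (map V js) ≈ F (map W js)
  form-map-cong form V≗W []       = refl
  form-map-cong form {V} {W} V≗W (j ∷ js) = trans
    (form-cong form (V≗W j) [] (map V js))
    (form-map-cong (contract-isForm (W j) form) V≗W js)

  -- Laplace expansion without index arithmetic: each column is picked in turn, and the columns
  -- skipped before it accumulate, in their original order, in the second argument of `φ`.
  alternatingSum : (Column → List Column → Carrier) → List Column → Carrier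
  alternatingSum φ []       = 0#
  alternatingSum φ (c ∷ cs) = φ c cs + - alternatingSum (λ c′ cs′ → φ c′ (c ∷ cs′)) cs

  alternatingSum-cong : ∀ {φ ψ} → (∀ c cs → φ c cs ≈ ψ c cs) → ∀ cs →
                        alternatingSum φ cs ≈ alternatingSum ψ cs
  alternatingSum-cong φ≈ψ []       = refl
  alternatingSum-cong φ≈ψ (c ∷ cs) =
    +-cong (φ≈ψ c cs) (-‿cong (alternatingSum-cong (λ c′ cs′ → φ≈ψ c′ (c ∷ cs′)) cs))

  alternatingSum-zero : ∀ {φ} → (∀ c cs → φ c cs ≈ 0#) → ∀ cs → alternatingSum φ cs ≈ 0#
  alternatingSum-zero φ≈0 []       = refl
  alternatingSum-zero φ≈0 (c ∷ cs) = trans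
    (+-cong (φ≈0 c cs) (-‿cong (alternatingSum-zero (λ c′ cs′ → φ≈0 c′ (c ∷ cs′)) cs)))
    (-‿inverseʳ 0#)

  combination-difference : ∀ a b x y x′ y′ →
    (a * x + b * y) + - (a * x′ + b * y′) ≈ a * (x + - x′) + b * (y + - y′)
  combination-difference = solve 6 (λ a b x y x′ y′ →
    (a :* x :+ b :* y) :+ :- (a :* x′ :+ b :* y′) := a :* (x :+ :- x′) :+ b :* (y :+ :- y′)) refl

  alternatingSum-linear : ∀ {a b φ ψ χ} → (∀ c cs → φ c cs ≈ a * ψ c cs + b * χ c cs) → ∀ cs →
    alternatingSum φ cs ≈ a * alternatingSum ψ cs + b * alternatingSum χ cs
  alternatingSum-linear {a} {b} φ≈ [] = sym (trans (+-cong (zeroʳ a) (zeroʳ b)) (+-identityʳ 0#))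
  alternatingSum-linear {a} {b} φ≈ (c ∷ cs) = trans
    (+-cong (φ≈ c cs) (-‿cong (alternatingSum-linear (λ c′ cs′ → φ≈ c′ (c ∷ cs′)) cs)))
    (combination-difference a b _ _ _ _)

  alternatingSum-multilinear : ∀ {φ} →
    (∀ {a b f g h} → Combination a b f g h → ∀ cs → φ f cs ≈ a * φ g cs + b * φ h cs) →
    (∀ c → Multilinear (φ c)) → Multilinear (alternatingSum φ)
  alternatingSum-multilinear linˡ linʳ {a} {b} comb [] post = trans
    (+-cong (linˡ comb post)
            (-‿cong (alternatingSum-linear (λ c cs → linʳ c comb [] cs) post)))
    (combination-difference a b _ _ _ _)
  alternatingSum-multilinear linˡ linʳ {a} {b} comb (c ∷ pre) post = trans
    (+-cong (linʳ c comb pre post)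
            (-‿cong (alternatingSum-multilinear (λ comb′ cs → linˡ comb′ (c ∷ cs))
                       (λ c′ comb′ pre′ → linʳ c′ comb′ (c ∷ pre′)) comb pre post)))
    (combination-difference a b _ _ _ _)

  alternatingSum-alternating : ∀ {φ} → (∀ c → Alternating (φ c)) → Alternating (alternatingSum φ)
  -- Picking either copy of `f` leaves the same list, with opposite signs; every later pick leaves
  -- both copies side by side.
  alternatingSum-alternating {φ} alt f [] post = begin
    φ f (f ∷ post) + - (φ f (f ∷ post) + - alternatingSum (λ c cs → φ c (f ∷ f ∷ cs)) post)
      ≈⟨ +-congˡ (-‿cong (+-congˡ (-‿cong (alternatingSum-zero (λ c cs → alt c f [] cs) post)))) ⟩
    φ f (f ∷ post) + - (φ f (f ∷ post) + - 0#)
      ≈⟨ solve 1 (λ x → x :+ :- (x :+ :- con 0ℤ) := con 0ℤ) refl _ ⟩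
    0# ∎
  alternatingSum-alternating alt f (c ∷ pre) post = trans
    (+-cong (alt c f pre post)
            (-‿cong (alternatingSum-alternating (λ c′ g pre′ → alt c′ g (c ∷ pre′)) f pre post)))
    (-‿inverseʳ 0#)

  -- A mismatch of lengths gives zero in both directions, which makes `minor rs` a form on lists of
  -- every length.
  minor : List ℕ → List Column → Carrier
  minor []       []      = 1#
  minor []       (_ ∷ _) = 0#
  minor (r ∷ rs)         = alternatingSum (λ c cs → c r * minor rs cs)

  minor-isForm : ∀ rs → IsForm (minor rs)
  minor-isForm [] = record { multilinear = lin ; alternating = alt }
    where
    lin : Multilinear (minor [])
    lin {a} {b} _ []      _ = sym (trans (+-cong (zeroʳ a) (zeroʳ b)) (+-identityʳ 0#))
    lin {a} {b} _ (_ ∷ _) _ = sym (trans (+-cong (zeroʳ a) (zeroʳ b)) (+-identityʳ 0#))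
    alt : Alternating (minor [])
    alt _ []      _ = refl
    alt _ (_ ∷ _) _ = refl
  minor-isForm (r ∷ rs) = record
    { multilinear = alternatingSum-multilinear
        (λ {a} {b} comb cs → trans (*-congʳ (comb r))
          (solve 5 (λ a b x y m → (a :* x :+ b :* y) :* m := a :* (x :* m) :+ b :* (y :* m)) refl a b _ _ _))
        (λ c {a} {b} comb pre post → trans (*-congˡ (multilinear (minor-isForm rs) comb pre post))
          (solve 5 (λ a b z x y → z :* (a :* x :+ b :* y) := a :* (z :* x) :+ b :* (z :* y)) refl a b _ _ _))
    ; alternating = alternatingSum-alternating
        (λ c f pre post → trans (*-congˡ (alternating (minor-isForm rs) f pre post)) (zeroʳ _))
    }

  alternatingSum-map : ∀ φ (σ : Column → Column) cs →
    alternatingSum φ (map σ cs) ≈ alternatingSum (λ c cs′ → φ (σ c) (map σ cs′)) cs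
  alternatingSum-map φ σ []       = refl
  alternatingSum-map φ σ (c ∷ cs) =
    +-congˡ (-‿cong (alternatingSum-map (λ c′ cs′ → φ c′ (σ c ∷ cs′)) σ cs))

  minor-shift : ∀ rs cs → minor (map suc rs) cs ≈ minor rs (map (_∘ suc) cs)
  minor-shift []       []      = refl
  minor-shift []       (_ ∷ _) = refl
  minor-shift (r ∷ rs) cs      = trans
    (alternatingSum-cong (λ c cs′ → *-congˡ (minor-shift rs cs′)) cs)
    (sym (alternatingSum-map (λ c cs′ → c r * minor rs cs′) (_∘ suc) cs))

-- Total positivity and tridiagonal matrices.

module TotalPositivity {c ℓ} (R : CommutativeRing c ℓ) where

  open CommutativeRing R hiding (zero)
  open IntegerSolver R
  open AlternatingForm R
  open IsForm

  record IsCone {n} (N : Pred Carrier n) : Set (c ⊔ ℓ ⊔ n) where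
    field
      resp : ∀ {x y} → x ≈ y → N x → N y
      0∈   : N 0#
      1∈   : N 1#
      +∈   : ∀ {x y} → N x → N y → N (x + y)
      *∈   : ∀ {x y} → N x → N y → N (x * y)

  data Strict : ℕ → List ℕ → Set where
    []  : ∀ {l} → Strict l []
    _∷_ : ∀ {l j js} → l ≤ j → Strict (suc j) js → Strict l (j ∷ js)

  data Weak : ℕ → List ℕ → Set where
    []  : ∀ {l} → Weak l []
    _∷_ : ∀ {l j js} → l ≤ j → Weak j js → Weak l (j ∷ js)

  weak-lower : ∀ {l l′ js} → l ≤ l′ → Weak l′ js → Weak l js
  weak-lower l≤l′ []         = []
  weak-lower l≤l′ (l′≤j ∷ w) = ℕ.≤-trans l≤l′ l′≤j ∷ w

  strict⊎repeated : ∀ {l js} → Weak l js →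
    Strict l js ⊎ (∃₂ λ pre j → ∃ λ post → js ≡ pre ++ j ∷ j ∷ post)
  strict⊎repeated [] = inj₁ []
  strict⊎repeated {js = j ∷ js} (l≤j ∷ w) with strict⊎repeated w
  ... | inj₂ (pre , i , post , eq) = inj₂ (j ∷ pre , i , post , ≡.cong (j ∷_) eq)
  ... | inj₁ [] = inj₁ (l≤j ∷ [])
  ... | inj₁ (_∷_ {j = k} {js = post} j≤k s) with j ℕ.≟ k
  ...   | yes ≡.refl = inj₂ ([] , j , post , ≡.refl)
  ...   | no j≢k     = inj₁ (l≤j ∷ (ℕ.≤∧≢⇒< j≤k j≢k ∷ s))

  -- An index set as a bit mask. The inductions on rows and on powers can then visit the indices 0,
  -- 1, 2, ... one at a time, each bit telling whether that index is selected.
  positions : List Bool → List ℕ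
  positions []           = []
  positions (false ∷ bs) = map suc (positions bs)
  positions (true  ∷ bs) = 0 ∷ map suc (positions bs)

  positions-replicate : ∀ d bs → positions (replicate d false ++ bs) ≡ map (d ℕ.+_) (positions bs)
  positions-replicate zero    bs = ≡.sym (map-id _)
  positions-replicate (suc d) bs = ≡.trans (≡.cong (map suc) (positions-replicate d bs)) (≡.sym (map-∘ (positions bs)))

  strict⇒positions : ∀ {l js} → Strict l js → ∃ λ bs → map (l ℕ.+_) (positions bs) ≡ js
  strict⇒positions []                         = [] , ≡.refl
  strict⇒positions {l} {j ∷ js} (l≤j ∷ s) with strict⇒positions s
  ... | bs , eq = replicate d false ++ true ∷ bs , (begin
    map (l ℕ.+_) (positions (replicate d false ++ true ∷ bs))
      ≡⟨ ≡.cong (map (l ℕ.+_)) (positions-replicate d (true ∷ bs)) ⟩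
    map (l ℕ.+_) (map (d ℕ.+_) (0 ∷ map suc (positions bs)))
      ≡⟨ map-∘ (0 ∷ map suc (positions bs)) ⟨
    l ℕ.+ (d ℕ.+ 0) ∷ map (λ k → l ℕ.+ (d ℕ.+ k)) (map suc (positions bs))
      ≡⟨ ≡.cong₂ _∷_ (≡.trans (≡.cong (l ℕ.+_) (ℕ.+-identityʳ d)) l+d≡j)
           (≡.trans (≡.sym (map-∘ (positions bs))) (map-cong shifted (positions bs))) ⟩
    j ∷ map (suc j ℕ.+_) (positions bs)
      ≡⟨ ≡.cong (j ∷_) eq ⟩
    j ∷ js ∎)
    where
    open ≡.≡-Reasoning
    d : ℕ
    d = j ℕ.∸ l
    l+d≡j : l ℕ.+ d ≡ j
    l+d≡j = ℕ.m+[n∸m]≡n l≤j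
    shifted : ∀ k → l ℕ.+ (d ℕ.+ suc k) ≡ suc j ℕ.+ k
    shifted k = ≡.trans (≡.sym (ℕ.+-assoc l d (suc k)))
      (≡.trans (≡.cong (ℕ._+ suc k) l+d≡j) (ℕ.+-suc j k))

  double : ℕ → ℕ
  double zero    = zero
  double (suc k) = suc (suc (double k))

  ⌊double/2⌋ : ∀ k → ⌊ double k /2⌋ ≡ k
  ⌊double/2⌋ zero    = ≡.refl
  ⌊double/2⌋ (suc k) = ≡.cong suc (⌊double/2⌋ k)

  ⌊1+double/2⌋ : ∀ k → ⌊ suc (double k) /2⌋ ≡ k
  ⌊1+double/2⌋ zero    = ≡.refl
  ⌊1+double/2⌋ (suc k) = ≡.cong suc (⌊1+double/2⌋ k)

  weave : (v w : ℕ → Column) → ℕ → Column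
  weave v w zero          = v 0
  weave v w (suc zero)    = w 0
  weave v w (suc (suc n)) = weave (v ∘ suc) (w ∘ suc) n

  weave-elim : ∀ {p} (P : ℕ → Column → Set p) {v w : ℕ → Column} →
    (∀ k → P (double k) (v k)) → (∀ k → P (suc (double k)) (w k)) → ∀ n → P n (weave v w n)
  weave-elim P v∈ w∈ zero          = v∈ 0
  weave-elim P v∈ w∈ (suc zero)    = w∈ 0
  weave-elim P v∈ w∈ (suc (suc n)) = weave-elim (λ n → P (suc (suc n))) (v∈ ∘ suc) (w∈ ∘ suc) n

  weave-double : ∀ v w k → weave v w (double k) ≡ v k
  weave-double v w zero    = ≡.refl
  weave-double v w (suc k) = weave-double (v ∘ suc) (w ∘ suc) k

  weave-1+double : ∀ v w k → weave v w (suc (double k)) ≡ w k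
  weave-1+double v w zero    = ≡.refl
  weave-1+double v w (suc k) = weave-1+double (v ∘ suc) (w ∘ suc) k

  module Tridiagonal (g h : ℕ → Carrier) (u : Carrier) where

    -- This is the map from a row vector f to f M, where M has `g (suc k)` in position (k, k + 1),
    -- `h k` in position (k, k) and `u` in position (k + 1, k). Hence `row n` is row 0 of the n-th
    -- power of M.
    step : (ℕ → Carrier) → ℕ → Carrier
    step f zero    = h 0 * f 0 + u * f 1
    step f (suc k) = g (suc k) * f k + (h (suc k) * f (suc k) + u * f (suc (suc k)))

    row : ℕ → ℕ → Carrier
    row zero    zero    = 1#
    row zero    (suc k) = 0#
    row (suc n)         = step (row n)

    stepColumns : (ℕ → Column) → ℕ → Column
    stepColumns V k i = step (λ k′ → V k′ i) k

  module _ {n} {N : Pred Carrier n} (cone : IsCone N) where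
    open IsCone cone

    Cancellable : Carrier → Set (c ⊔ n)
    Cancellable κ = ∀ {x} → N (κ * x) → N x

    TotallyPositive : (List Column → Carrier) → (ℕ → Column) → Set n
    TotallyPositive F V = ∀ {js} → Strict 0 js → N (F (map V js))

    positive-weak : ∀ {F} → IsForm F → ∀ {V} → TotallyPositive F V →
                    ∀ {js} → Weak 0 js → N (F (map V js))
    positive-weak {F} form {V} V≥0 w with strict⊎repeated w
    ... | inj₁ s = V≥0 s
    ... | inj₂ (pre , j , post , ≡.refl) =
      resp (sym (trans (reflexive (≡.cong F (map-++ V pre (j ∷ j ∷ post))))
                       (alternating form (V j) (map V pre) (map V post)))) 0∈

    -- `divide` is present because the factorization describes only the multiple κ M of the
    -- tridiagonal matrix; it returns from κ M to M inside a minor.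
    data Span (V : ℕ → Column) (l h : ℕ) : Column → Set (c ⊔ ℓ ⊔ n) where
      generator : ∀ {i} → l ≤ i → i ≤ h → Span V l h (V i)
      combine   : ∀ {a b f g g′} → N a → N b → Span V l h g → Span V l h g′ →
                  Combination a b f g g′ → Span V l h f
      divide    : ∀ {κ f g} → Cancellable κ → Span V l h g → (∀ i → g i ≈ κ * f i) → Span V l h f

    span⇒≤ : ∀ {V l h f} → Span V l h f → l ≤ h
    span⇒≤ (generator l≤i i≤h)  = ℕ.≤-trans l≤i i≤h
    span⇒≤ (combine _ _ s _ _)  = span⇒≤ s
    span⇒≤ (divide _ s _)       = span⇒≤ s

    -- If h j ≤ l (j + 1), expanding F (V′ j₁ ∷ V′ j₂ ∷ …) by multilinearity only
    -- produces weakly increasing sequences of columns of V.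
    span-positive : ∀ {V V′ : ℕ → Column} {l h : ℕ → ℕ} →
      (∀ j → Span V (l j) (h j) (V′ j)) → (∀ j → h j ≤ l (suc j)) →
      ∀ {F} → IsForm F → ∀ m → (∀ {is} → Weak (l m) is → N (F (map V is))) →
      ∀ {js} → Strict m js → N (F (map V′ js))
    span-positive {V} {V′} {l} {h} V′∈ h≤l form m V≥0 [] = V≥0 []
    span-positive {V} {V′} {l} {h} V′∈ h≤l {F} form m V≥0 {j ∷ js} (m≤j ∷ s) = head-column (V′∈ j)
      where
      l-mono : ∀ {j} → m ℕ.≤′ j → l m ≤ l j
      l-mono ℕ.≤′-refl       = ℕ.≤-refl
      l-mono (ℕ.≤′-step m≤′j) = ℕ.≤-trans (l-mono m≤′j) (ℕ.≤-trans (span⇒≤ (V′∈ _)) (h≤l _))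
      head-column : ∀ {f} → Span V (l j) (h j) f → N (F (f ∷ map V′ js))
      head-column (generator {i} l≤i i≤h) =
        span-positive V′∈ h≤l (contract-isForm (V i) form) (suc j)
          (λ w → V≥0 (ℕ.≤-trans (l-mono (ℕ.≤⇒≤′ m≤j)) l≤i ∷ weak-lower (ℕ.≤-trans i≤h (h≤l j)) w)) s
      head-column (combine a∈ b∈ s₁ s₂ comb) =
        resp (sym (multilinear form comb [] _))
             (+∈ (*∈ a∈ (head-column s₁)) (*∈ b∈ (head-column s₂)))
      head-column (divide {κ} {f} {g} cancel s₁ g≈κf) =
        cancel (resp (trans (multilinear form {κ} {0#} {g} {f} {f} (λ i → trans (g≈κf i) (κ0 κ (f i))) [] _)
                            (sym (κ0 κ _)))
                     (head-column s₁))
        where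
        κ0 : ∀ κ x → κ * x ≈ κ * x + 0# * x
        κ0 κ x = sym (trans (+-congˡ (zeroˡ x)) (+-identityʳ _))

    module _ {g h : ℕ → Carrier} {u : Carrier} where
      open Tridiagonal g h u

      -- Up to the factor κ, the tridiagonal matrix is a product of bidiagonal
      -- matrices with a nonnegative diagonal matrix added to it.
      record Factorization : Set (c ⊔ ℓ ⊔ n) where
        field
          κ         : Carrier
          κ-cancel  : Cancellable κ
          A B C E F : ℕ → Carrier
          A∈        : ∀ k → N (A k)
          B∈        : ∀ k → N (B k)
          C∈        : ∀ k → N (C k)
          E∈        : ∀ k → N (E k)
          F∈        : ∀ k → N (F k)
          κg        : ∀ k → κ * g (suc k) ≈ C (suc k) * A k
          κh₀       : κ * h 0 ≈ E 0 + F 0 * A 0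
          κh        : ∀ k → κ * h (suc k) ≈ C (suc k) * B k + (E (suc k) + F (suc k) * A (suc k))
          κu        : ∀ k → κ * u ≈ F k * B k

      module _ (factorization : Factorization) where
        open Factorization factorization

        module _ (V : ℕ → Column) where

          rail : ℕ → Column
          rail k i = A k * V k i + B k * V (suc k) i

          -- Each `V k` sits between `rail` at k - 1 and `rail k`, and κ times the stepped column k
          -- is a nonnegative combination of these three neighbours. The summand `E k * V k` thus
          -- costs nothing, and the triples for k and k + 1 overlap only in `rail k`.
          woven : ℕ → Column
          woven = weave V rail

          woven-span : ∀ n → Span V ⌊ n /2⌋ ⌊ suc n /2⌋ (woven n)
          woven-span = weave-elim (λ n → Span V ⌊ n /2⌋ ⌊ suc n /2⌋)
            (λ k → generator (ℕ.≤-reflexive (⌊double/2⌋ k)) (ℕ.≤-reflexive (≡.sym (⌊1+double/2⌋ k))))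
            (λ k → combine (A∈ k) (B∈ k)
               (generator (ℕ.≤-reflexive (⌊1+double/2⌋ k)) (ℕ.m≤n⇒m≤1+n (ℕ.≤-reflexive (≡.sym (⌊double/2⌋ k)))))
               (generator (ℕ.m≤n⇒m≤1+n (ℕ.≤-reflexive (⌊1+double/2⌋ k))) (s≤s (ℕ.≤-reflexive (≡.sym (⌊double/2⌋ k)))))
               (λ _ → refl))

          -- The woven position 2 k - 1 of the rail before `V k`, cut off at 0 because `V 0` has no
          -- such rail.
          lowest : ℕ → ℕ
          lowest zero    = zero
          lowest (suc k) = suc (double k)

          column∈ : ∀ {l m} k → l ≤ double k → double k ≤ m → Span woven l m (V k)
          column∈ k l≤ ≤m = ≡.subst (Span woven _ _) (weave-double V rail k) (generator l≤ ≤m)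

          rail∈ : ∀ {l m} k → l ≤ suc (double k) → suc (double k) ≤ m → Span woven l m (rail k)
          rail∈ k l≤ ≤m = ≡.subst (Span woven _ _) (weave-1+double V rail k) (generator l≤ ≤m)

          step-span : ∀ k → Span woven (lowest k) (suc (double k)) (stepColumns V k)
          step-span zero = divide κ-cancel
            (combine {f = λ i → E 0 * V 0 i + F 0 * rail 0 i} (E∈ 0) (F∈ 0)
               (column∈ 0 z≤n z≤n) (rail∈ 0 z≤n ℕ.≤-refl) (λ _ → refl))
            (λ i → trans
              (solve 6 (λ A B E F x y → E :* x :+ F :* (A :* x :+ B :* y) := (E :+ F :* A) :* x :+ F :* B :* y)
                 refl (A 0) (B 0) (E 0) (F 0) (V 0 i) (V 1 i))
              (trans (+-cong (*-congʳ (sym κh₀)) (*-congʳ (sym (κu 0))))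
                (solve 5 (λ κ h u x y → κ :* h :* x :+ κ :* u :* y := κ :* (h :* x :+ u :* y))
                   refl κ (h 0) u (V 0 i) (V 1 i))))
          step-span (suc k) = divide κ-cancel
            (combine {f = λ i → C (suc k) * rail k i + 1# * (E (suc k) * V (suc k) i + F (suc k) * rail (suc k) i)}
               (C∈ (suc k)) 1∈ (rail∈ k ℕ.≤-refl (ℕ.m≤n⇒m≤1+n (ℕ.n≤1+n _)))
               (combine (E∈ (suc k)) (F∈ (suc k)) (column∈ (suc k) (ℕ.n≤1+n _) (ℕ.n≤1+n _))
                  (rail∈ (suc k) (ℕ.m≤n⇒m≤1+n (ℕ.n≤1+n _)) ℕ.≤-refl) (λ _ → refl))
               (λ _ → refl))
            (λ i → trans
              (solve 10 (λ A A′ B B′ C E F x y z →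
                   C :* (A :* x :+ B :* y) :+ con 1ℤ :* (E :* y :+ F :* (A′ :* y :+ B′ :* z))
                := C :* A :* x :+ ((C :* B :+ (E :+ F :* A′)) :* y :+ F :* B′ :* z))
                 refl (A k) (A (suc k)) (B k) (B (suc k)) (C (suc k)) (E (suc k)) (F (suc k))
                 (V k i) (V (suc k) i) (V (suc (suc k)) i))
              (trans (+-cong (*-congʳ (sym (κg k))) (+-cong (*-congʳ (sym (κh k))) (*-congʳ (sym (κu (suc k))))))
                (solve 7 (λ κ g h u x y z → κ :* g :* x :+ (κ :* h :* y :+ κ :* u :* z)
                                         := κ :* (g :* x :+ (h :* y :+ u :* z)))
                   refl κ (g (suc k)) (h (suc k)) u (V k i) (V (suc k) i) (V (suc (suc k)) i))))

          woven-positive : ∀ {F} → IsForm F → TotallyPositive F V → TotallyPositive F woven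
          woven-positive form V≥0 = span-positive woven-span (λ _ → ℕ.≤-refl) form 0 (positive-weak form V≥0)

          step-positive : ∀ {F} → IsForm F → TotallyPositive F V → TotallyPositive F (stepColumns V)
          step-positive form V≥0 = span-positive step-span (λ _ → ℕ.≤-refl) form 0
            (positive-weak form (woven-positive form V≥0))

          -- `V 0` is the woven column 0, so putting it in front of any weakly increasing list of
          -- woven columns gives a weakly increasing list again.
          step-positive₀ : ∀ {F} → IsForm F → TotallyPositive F V →
                           TotallyPositive (contract (V 0) F) (stepColumns V)
          step-positive₀ form V≥0 = span-positive step-span (λ _ → ℕ.≤-refl) (contract-isForm (V 0) form) 0
            (λ w → positive-weak form (woven-positive form V≥0) (z≤n ∷ w))

        rows : ℕ → ℕ → Column
        rows m k i = row (m ℕ.+ i) k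

        -- Meant for row 0 of `rows 0`, the unit vector (1, 0, 0, ...): in an expansion along it
        -- only column 0 can contribute.
        alternatingSum-zeroRow : ∀ {V : ℕ → Column} r F → (∀ k → V (suc k) r ≈ 0#) → ∀ {js} → Strict 1 js →
          alternatingSum (λ c cs → c r * F cs) (map V js) ≈ 0#
        alternatingSum-zeroRow r F V≈0 [] = refl
        alternatingSum-zeroRow {V} r F V≈0 (s≤s {n = j} _ ∷ s) = trans
          (+-cong (trans (*-congʳ (V≈0 j)) (zeroˡ _))
                  (-‿cong (alternatingSum-zeroRow r (F ∘ (V (suc j) ∷_)) V≈0 (raise s))))
          (-‿inverseʳ 0#)
          where
          raise : ∀ {j js} → Strict (suc j) js → Strict 1 js
          raise []         = []
          raise (s≤s _ ∷ s) = s≤s z≤n ∷ s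

        -- Induction on the mask. Without row 0, the remaining matrix is the original one with its
        -- columns stepped, by the definition of `row`. With row 0, a minor that uses column 0
        -- reduces to one on later rows and columns, and any other minor vanishes.
        rows-positive : ∀ bs → TotallyPositive (minor (positions bs)) (rows 0)
        rows-positive-suc : ∀ bs → TotallyPositive (minor (map suc (positions bs))) (rows 0)

        rows-positive-suc bs {js} s =
          resp (sym (trans (minor-shift (positions bs) (map (rows 0) js))
                           (reflexive (≡.cong (minor (positions bs)) (≡.sym (map-∘ js))))))
               (step-positive (rows 0) (minor-isForm (positions bs)) (rows-positive bs) s)

        rows-positive []           []      = 1∈
        rows-positive []           (_ ∷ _) = 0∈
        rows-positive (false ∷ bs) s       = rows-positive-suc bs s
        rows-positive (true ∷ bs)  []      = 0∈
        rows-positive (true ∷ bs) {zero ∷ js} (_ ∷ s) = resp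
          (sym (trans (+-cong (*-identityˡ _) (-‿cong
                  (alternatingSum-zeroRow 0 (minor (map suc (positions bs)) ∘ (rows 0 0 ∷_)) (λ _ → refl) s)))
                (solve 1 (λ x → x :+ :- con 0ℤ := x) refl _)))
          (rows-positive-suc bs (lower s))
          where
          lower : ∀ {l js} → Strict (suc l) js → Strict 0 js
          lower []      = []
          lower (_ ∷ s) = z≤n ∷ s
        rows-positive (true ∷ bs) {suc j ∷ js} (_ ∷ s) = resp
          (sym (alternatingSum-zeroRow {rows 0} 0 (minor (map suc (positions bs))) (λ _ → refl) (s≤s z≤n ∷ s))) 0∈

        power : ℕ → (ℕ → Column) → ℕ → Column
        power zero    V = V
        power (suc j) V = power j (stepColumns V)

        power-positive : ∀ {F} → IsForm F → ∀ {V} → TotallyPositive F V →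
                         ∀ bs → N (F (map (λ j → power j V 0) (positions bs)))
        power-positive form V≥0 [] = V≥0 []
        power-positive {F} form {V} V≥0 (false ∷ bs) =
          resp (reflexive (≡.cong F (map-∘ (positions bs))))
            (power-positive form (step-positive V form V≥0) bs)
        power-positive {F} form {V} V≥0 (true ∷ bs) =
          resp (reflexive (≡.cong (contract (V 0) F) (map-∘ (positions bs))))
            (power-positive (contract-isForm (V 0) form) (step-positive₀ V form V≥0) bs)

        power-rows : ∀ j m k i → power j (rows m) k i ≡ row (j ℕ.+ m ℕ.+ i) k
        power-rows zero    m k i = ≡.refl
        power-rows (suc j) m k i = ≡.trans (power-rows j (suc m) k i)
          (≡.cong (λ n → row (n ℕ.+ i) k) (ℕ.+-suc j m))

        -- Row i of `rows 0` times column 0 of the j-th power of M is the (0, 0) entry of the power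
        -- i + j, that is, the Hankel entry. One mask selects the rows i, the other the powers j.
        hankel-positive : ∀ {rs js} → Strict 0 rs → Strict 0 js →
                          N (minor rs (map (λ j i → row (i ℕ.+ j) 0) js))
        hankel-positive s s′ with strict⇒positions s | strict⇒positions s′
        ... | bs , ≡.refl | bs′ , ≡.refl = ≡.subst₂ (λ rs js → N (minor rs (map _ js)))
          (≡.sym (map-id (positions bs))) (≡.sym (map-id (positions bs′)))
          (resp
            (form-map-cong (minor-isForm (positions bs))
               (λ j i → reflexive (≡.trans (power-rows j 0 0 i)
                 (≡.cong (λ n → row n 0) (≡.trans (≡.cong (ℕ._+ i) (ℕ.+-identityʳ j)) (ℕ.+-comm j i)))))
               (positions bs′))
            (power-positive (minor-isForm (positions bs)) (rows-positive bs) bs′))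

-- Iterated log-convexity from Hankel determinants.

module LogConvexity {c ℓ} (R : CommutativeRing c ℓ) where
  open CommutativeRing R
  open IntegerSolver R
  open AlternatingForm R
  open TotalPositivity R

  L : (ℕ → Carrier) → ℕ → Carrier
  L α j = α j * α (suc (suc j)) + - (α (suc j) * α (suc j))

  hankelMinor : List ℕ → (ℕ → Carrier) → List ℕ → Carrier
  hankelMinor rs α js = minor rs (map (λ j i → α (i ℕ.+ j)) js)

  connected : ℕ → ℕ → List ℕ
  connected 0       j = []
  connected (suc r) j = j ∷ connected r (suc j)

  connected-strict : ∀ r j → Strict j (connected r j)
  connected-strict 0       j = []
  connected-strict (suc r) j = ℕ.≤-refl ∷ connected-strict r (suc j)

  private
    -- A syntactic copy of `minor` whose interpretation computes to the determinant in the ring, so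
    -- that the solver can prove determinant identities.
    minorᴾ : ∀ {n} → List ℕ → List (ℕ → Polynomial n) → Polynomial n
    sumᴾ : ∀ {n} → ((ℕ → Polynomial n) → List (ℕ → Polynomial n) → Polynomial n) →
           List (ℕ → Polynomial n) → Polynomial n
    sumᴾ φ []       = con 0ℤ
    sumᴾ φ (c ∷ cs) = φ c cs :+ :- sumᴾ (λ c′ cs′ → φ c′ (c ∷ cs′)) cs
    minorᴾ []       []      = con 1ℤ
    minorᴾ []       (_ ∷ _) = con 0ℤ
    minorᴾ (r ∷ rs)         = sumᴾ (λ c cs → c r :* minorᴾ rs cs)

    nth : ∀ {n} → List (Polynomial n) → ℕ → Polynomial n
    nth []       _       = con 0ℤ
    nth (x ∷ xs) 0       = x
    nth (x ∷ xs) (suc n) = nth xs n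

    hankelᴾ : ∀ {n} → ℕ → List (Polynomial n) → Polynomial n
    hankelᴾ r xs = minorᴾ (connected r 0) (map (λ j i → nth xs (i ℕ.+ j)) (connected r 0))

  hankelDet : ℕ → (ℕ → Carrier) → ℕ → Carrier
  hankelDet r α j = hankelMinor (connected r 0) α (connected r j)

  L≈hankelDet : ∀ α j → L α j ≈ hankelDet 2 α j
  L≈hankelDet α j = solve 3 (λ a b c → a :* c :+ :- (b :* b) := hankelᴾ 2 (a ∷ b ∷ c ∷ []))
    refl (α j) (α (1 ℕ.+ j)) (α (2 ℕ.+ j))

  -- Condensation of the 3 by 3 Hankel matrix: its connected 2 by 2 corner minors are `L α` at j, j
  -- + 1, j + 1 and j + 2, and its centre is `α (2 + j)`. The next lemma is the same identity one
  -- size up, with centre `L α (2 + j)`.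
  L²≈ : ∀ α j → L (L α) j ≈ α (2 ℕ.+ j) * hankelDet 3 α j
  L²≈ α j = solve 5 (λ a b c d e →
      (a :* c :+ :- (b :* b)) :* (c :* e :+ :- (d :* d)) :+ :- ((b :* d :+ :- (c :* c)) :* (b :* d :+ :- (c :* c)))
      := c :* hankelᴾ 3 (a ∷ b ∷ c ∷ d ∷ e ∷ []))
    refl (α j) (α (1 ℕ.+ j)) (α (2 ℕ.+ j)) (α (3 ℕ.+ j)) (α (4 ℕ.+ j))

  desnanot-jacobi : ∀ α j → L (hankelDet 3 α) j ≈ hankelDet 4 α j * L α (2 ℕ.+ j)
  desnanot-jacobi α j = solve 7 (λ a b c d e f g →
      hankelᴾ 3 (a ∷ b ∷ c ∷ d ∷ e ∷ []) :* hankelᴾ 3 (c ∷ d ∷ e ∷ f ∷ g ∷ [])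
        :+ :- (hankelᴾ 3 (b ∷ c ∷ d ∷ e ∷ f ∷ []) :* hankelᴾ 3 (b ∷ c ∷ d ∷ e ∷ f ∷ []))
      := hankelᴾ 4 (a ∷ b ∷ c ∷ d ∷ e ∷ f ∷ g ∷ []) :* (c :* e :+ :- (d :* d)))
    refl (α j) (α (1 ℕ.+ j)) (α (2 ℕ.+ j)) (α (3 ℕ.+ j)) (α (4 ℕ.+ j)) (α (5 ℕ.+ j)) (α (6 ℕ.+ j))

  L-cong : ∀ {α β} → (∀ j → α j ≈ β j) → ∀ j → L α j ≈ L β j
  L-cong α≈β j = +-cong (*-cong (α≈β _) (α≈β _)) (-‿cong (*-cong (α≈β _) (α≈β _)))

  -- Adding and subtracting α j α (2 + j) β (1 + j)² moves all signs inside `L α` and `L β`. This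
  -- opens up the product found for the second iterate.
  L-* : ∀ α β j → L (λ j → α j * β j) j ≈ α j * α (2 ℕ.+ j) * L β j + β (1 ℕ.+ j) * β (1 ℕ.+ j) * L α j
  L-* α β j = solve 6 (λ a b c x y z →
      a :* x :* (c :* z) :+ :- (b :* y :* (b :* y))
      := a :* c :* (x :* z :+ :- (y :* y)) :+ y :* y :* (a :* c :+ :- (b :* b)))
    refl (α j) (α (1 ℕ.+ j)) (α (2 ℕ.+ j)) (β j) (β (1 ℕ.+ j)) (β (2 ℕ.+ j))

  L³≈ : ∀ α j → L (L (L α)) j ≈ α (2 ℕ.+ j) * α (4 ℕ.+ j) * (hankelDet 4 α j * L α (2 ℕ.+ j))
                              + hankelDet 3 α (1 ℕ.+ j) * hankelDet 3 α (1 ℕ.+ j) * L α (2 ℕ.+ j)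
  L³≈ α j = trans (L-cong (L²≈ α) j)
    (trans (L-* (λ j → α (2 ℕ.+ j)) (hankelDet 3 α) j) (+-congʳ (*-congˡ (desnanot-jacobi α j))))

  module _ {n} {N : Pred Carrier n} (cone : IsCone N) (α : ℕ → Carrier)
           (α∈ : ∀ {rs js} → Strict 0 rs → Strict 0 js → N (hankelMinor rs α js)) where
    open IsCone cone

    hankelDet∈ : ∀ r j → N (hankelDet r α j)
    hankelDet∈ r j = α∈ (connected-strict r 0) (raise (connected-strict r j))
      where
      raise : ∀ {l js} → Strict l js → Strict 0 js
      raise []      = []
      raise (_ ∷ s) = z≤n ∷ s

    term∈ : ∀ j → N (α j)
    term∈ j = resp (solve 1 (λ x → hankelᴾ 1 (x ∷ []) := x) refl (α j)) (hankelDet∈ 1 j)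

    L∈ : ∀ j → N (L α j)
    L∈ j = resp (sym (L≈hankelDet α j)) (hankelDet∈ 2 j)

    L²∈ : ∀ j → N (L (L α) j)
    L²∈ j = resp (sym (L²≈ α j)) (*∈ (term∈ _) (hankelDet∈ 3 j))

    L³∈ : ∀ j → N (L (L (L α)) j)
    L³∈ j = resp (sym (L³≈ α j))
      (+∈ (*∈ (*∈ (term∈ _) (term∈ _)) (*∈ (hankelDet∈ 4 j) (L∈ _)))
          (*∈ (*∈ (hankelDet∈ 3 _) (hankelDet∈ 3 _)) (L∈ _)))

-- Sequences generated by a derivation as tridiagonal moments.

module Moments {c ℓ} (R : CommutativeRing c ℓ) where
  open CommutativeRing R hiding (zero)
  open IntegerSolver R
  open import Algebra.Properties.Ring ring
  open import Relation.Binary.Reasoning.Setoid setoid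
  open TotalPositivity R

  #_ : ℕ → Carrier
  # zero  = 0#
  # suc n = 1# + # n

  infix 9 #_

  record IsDerivation (θ : Carrier → Carrier) : Set (c ⊔ ℓ) where
    field
      θ-cong : ∀ {x y} → x ≈ y → θ x ≈ θ y
      θ-+    : ∀ x y → θ (x + y) ≈ θ x + θ y
      θ-*    : ∀ x y → θ (x * y) ≈ θ x * y + x * θ y

    θ-0 : θ 0# ≈ 0#
    θ-0 = +-cancelˡ (θ 0#) _ _ (begin
      θ 0# + θ 0#  ≈⟨ θ-+ 0# 0# ⟨
      θ (0# + 0#)  ≈⟨ θ-cong (+-identityˡ 0#) ⟩
      θ 0#         ≈⟨ +-identityʳ _ ⟨
      θ 0# + 0#    ∎)

    θ-1 : θ 1# ≈ 0#
    θ-1 = +-cancelˡ (θ 1#) _ _ (begin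
      θ 1# + θ 1#            ≈⟨ +-cong (*-identityʳ _) (*-identityˡ _) ⟨
      θ 1# * 1# + 1# * θ 1#  ≈⟨ θ-* 1# 1# ⟨
      θ (1# * 1#)            ≈⟨ θ-cong (*-identityˡ 1#) ⟩
      θ 1#                   ≈⟨ +-identityʳ _ ⟨
      θ 1# + 0#              ∎)

    θ-# : ∀ n → θ (# n) ≈ 0#
    θ-# zero    = θ-0
    θ-# (suc n) = trans (θ-+ 1# (# n)) (trans (+-cong θ-1 (θ-# n)) (+-identityˡ 0#))

  -- The subdiagonal entry is k γ + ζ k (k - 1) / 2, written as a sum of increments because the ring
  -- need not allow halving.
  subdiagonal diagonal : Carrier → Carrier → ℕ → Carrier
  subdiagonal γ ζ zero    = 0#
  subdiagonal γ ζ (suc k) = subdiagonal γ ζ k + (γ + # k * ζ)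
  diagonal s ω zero       = s
  diagonal s ω (suc k)    = diagonal s ω k + ω

  module _ {θ : Carrier → Carrier} (derivation : IsDerivation θ) (κ η s u ω γ ζ : Carrier) where
    open IsDerivation derivation

    private
      sub diag : ℕ → Carrier
      sub  = subdiagonal γ ζ
      diag = diagonal s ω

    open Tridiagonal sub diag u using (row)

    -- The operator on polynomials of degree n.
    ξ : ℕ → Carrier → Carrier
    ξ n x = κ * θ x + # n * η * x

    ξ₁ : Carrier → Carrier
    ξ₁ x = κ * θ x + η * x

    ξ₁-+ : ∀ x y → ξ₁ (x + y) ≈ ξ₁ x + ξ₁ y
    ξ₁-+ x y = trans (+-congʳ (*-congˡ (θ-+ x y)))
      (solve 6 (λ κ η x y x′ y′ → κ :* (x′ :+ y′) :+ η :* (x :+ y) := (κ :* x′ :+ η :* x) :+ (κ :* y′ :+ η :* y))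
         refl κ η x y (θ x) (θ y))

    ξ-+ : ∀ n x y → ξ n (x + y) ≈ ξ n x + ξ n y
    ξ-+ n x y = trans (+-congʳ (*-congˡ (θ-+ x y)))
      (solve 6 (λ κ η x y x′ y′ → κ :* (x′ :+ y′) :+ η :* (x :+ y) := (κ :* x′ :+ η :* x) :+ (κ :* y′ :+ η :* y))
         refl κ (# n * η) x y (θ x) (θ y))

    -- The Leibniz rule of the homogenised derivation: of the total degree n + 1, the linear factor
    -- x takes 1 and y takes n.
    ξ-* : ∀ n x y → ξ (suc n) (x * y) ≈ ξ₁ x * y + x * ξ n y
    ξ-* n x y = trans (+-congʳ (*-congˡ (θ-* x y)))
      (solve 7 (λ κ η n x y x′ y′ → κ :* (x′ :* y :+ x :* y′) :+ (con 1ℤ :+ n) :* η :* (x :* y)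
                                 := (κ :* x′ :+ η :* x) :* y :+ x :* (κ :* y′ :+ n :* η :* y))
         refl κ η (# n) x y (θ x) (θ y))

    ξ₁-#* : ∀ k x → ξ₁ (# k * x) ≈ # k * ξ₁ x
    ξ₁-#* k x = trans (+-congʳ (*-congˡ (trans (θ-* (# k) x) (+-congʳ (*-congʳ (θ-# k))))))
      (solve 5 (λ κ η k x x′ → κ :* (con 0ℤ :* x :+ k :* x′) :+ η :* (k :* x) := k :* (κ :* x′ :+ η :* x))
         refl κ η (# k) x (θ x))

    module _ (ξu : ξ₁ u + u * u ≈ u * ω) (ξs : ξ₁ s ≈ u * γ) (ξω : ξ₁ ω ≈ u * ζ)
             (ξγ : ξ₁ γ ≈ u * γ) (ξζ : ξ₁ ζ ≈ u * ζ) where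

      ξ₁-diag : ∀ k → ξ₁ (diag k) ≈ u * (γ + # k * ζ)
      ξ₁-diag zero    = trans ξs (solve 3 (λ u γ ζ → u :* γ := u :* (γ :+ con 0ℤ :* ζ)) refl u γ ζ)
      ξ₁-diag (suc k) = trans (ξ₁-+ _ _) (trans (+-cong (ξ₁-diag k) ξω)
        (solve 4 (λ u γ ζ k → u :* (γ :+ k :* ζ) :+ u :* ζ := u :* (γ :+ (con 1ℤ :+ k) :* ζ)) refl u γ ζ (# k)))

      ξ₁-sub : ∀ k → ξ₁ (sub k) ≈ u * sub k
      ξ₁-sub zero    = trans (+-congʳ (*-congˡ θ-0))
        (solve 3 (λ κ η u → κ :* con 0ℤ :+ η :* con 0ℤ := u :* con 0ℤ) refl κ η u)
      ξ₁-sub (suc k) = trans (ξ₁-+ _ _) (trans (+-cong (ξ₁-sub k) (trans (ξ₁-+ _ _)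
          (+-cong ξγ (trans (ξ₁-#* k ζ) (*-congˡ ξζ)))))
        (solve 5 (λ u g γ k ζ → u :* g :+ (u :* γ :+ k :* (u :* ζ)) := u :* (g :+ (γ :+ k :* ζ)))
           refl u (sub k) γ (# k) ζ))

      ξ₁-u : ξ₁ u ≈ u * ω + - (u * u)
      ξ₁-u = trans (solve 2 (λ x y → x := x :+ y :+ :- y) refl (ξ₁ u) (u * u)) (+-congʳ ξu)

      ξ-zero : ∀ n → ξ n 0# ≈ 0#
      ξ-zero n = trans (+-cong (trans (*-congˡ θ-0) (zeroʳ κ)) (zeroʳ _)) (+-identityʳ 0#)

      -- Induction on n. Comparing the coefficients of the entries of `row n` on both sides asks for
      -- ξ₁ g = u g on the subdiagonal, for ξ₁ of the k-th diagonal entry to be u times the next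
      -- increment of the subdiagonal, and for ξ₁ u = u (ω - u). As the diagonal is affine in k and
      -- the subdiagonal quadratic, this comes down to the five hypotheses.
      ξ-row : ∀ n k → ξ n (row n k) ≈ u * (row n (suc k) + # k * row n k)
      ξ-row zero zero = trans (+-congʳ (*-congˡ θ-1))
        (solve 3 (λ κ η u → κ :* con 0ℤ :+ con 0ℤ :* η :* con 1ℤ
                         := u :* (con 0ℤ :+ con 0ℤ :* con 1ℤ)) refl κ η u)
      ξ-row zero (suc k) = trans (ξ-zero 0)
        (solve 2 (λ u k → con 0ℤ := u :* (con 0ℤ :+ k :* con 0ℤ)) refl u (# suc k))
      ξ-row (suc n) zero = begin
        ξ (suc n) (s * x + u * y)
          ≈⟨ trans (ξ-+ (suc n) _ _) (+-cong (ξ-* n s x) (ξ-* n u y)) ⟩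
        (ξ₁ s * x + s * ξ n x) + (ξ₁ u * y + u * ξ n y)
          ≈⟨ +-cong (+-cong (*-congʳ ξs) (*-congˡ (ξ-row n 0))) (+-cong (*-congʳ ξ₁-u) (*-congˡ (ξ-row n 1))) ⟩
        (u * γ * x + s * (u * (y + 0# * x))) + ((u * ω + - (u * u)) * y + u * (u * (z + (1# + 0#) * y)))
          ≈⟨ solve 8 (λ s u ω γ ζ x y z →
               (u :* γ :* x :+ s :* (u :* (y :+ con 0ℤ :* x)))
                 :+ ((u :* ω :+ :- (u :* u)) :* y :+ u :* (u :* (z :+ (con 1ℤ :+ con 0ℤ) :* y)))
               := u :* (((con 0ℤ :+ (γ :+ con 0ℤ :* ζ)) :* x :+ ((s :+ ω) :* y :+ u :* z))
                        :+ con 0ℤ :* (s :* x :+ u :* y))) refl s u ω γ ζ x y z ⟩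
        u * (row (suc n) 1 + 0# * row (suc n) 0) ∎
        where
        x y z : Carrier
        x = row n 0
        y = row n 1
        z = row n 2
      ξ-row (suc n) (suc k) = begin
        ξ (suc n) (g * w + (h * x + u * y))
          ≈⟨ trans (ξ-+ (suc n) _ _) (+-cong (ξ-* n g w) (trans (ξ-+ (suc n) _ _) (+-cong (ξ-* n h x) (ξ-* n u y)))) ⟩
        (ξ₁ g * w + g * ξ n w) + ((ξ₁ h * x + h * ξ n x) + (ξ₁ u * y + u * ξ n y))
          ≈⟨ +-cong (+-cong (*-congʳ (ξ₁-sub (suc k))) (*-congˡ (ξ-row n k)))
               (+-cong (+-cong (*-congʳ (ξ₁-diag (suc k))) (*-congˡ (ξ-row n (suc k))))
                       (+-cong (*-congʳ ξ₁-u) (*-congˡ (ξ-row n (suc (suc k)))))) ⟩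
        (u * g * w + g * (u * (x + # k * w)))
          + ((u * (γ + # suc k * ζ) * x + h * (u * (y + # suc k * x)))
             + ((u * ω + - (u * u)) * y + u * (u * (z + # suc (suc k) * y))))
          ≈⟨ solve 11 (λ g h u ω γ ζ k w x y z →
               (u :* g :* w :+ g :* (u :* (x :+ k :* w)))
               :+ ((u :* (γ :+ (con 1ℤ :+ k) :* ζ) :* x :+ h :* (u :* (y :+ (con 1ℤ :+ k) :* x)))
                 :+ ((u :* ω :+ :- (u :* u)) :* y :+ u :* (u :* (z :+ (con 1ℤ :+ (con 1ℤ :+ k)) :* y))))
               := u :* (((g :+ (γ :+ (con 1ℤ :+ k) :* ζ)) :* x :+ ((h :+ ω) :* y :+ u :* z))
                        :+ (con 1ℤ :+ k) :* (g :* w :+ (h :* x :+ u :* y))))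
               refl g h u ω γ ζ (# k) w x y z ⟩
        u * (row (suc n) (suc (suc k)) + # suc k * row (suc n) (suc k)) ∎
        where
        g h w x y z : Carrier
        g = sub (suc k)
        h = diag (suc k)
        w = row n k
        x = row n (suc k)
        y = row n (suc (suc k))
        z = row n (suc (suc (suc k)))

      -- At k = 0 the term with `# k` drops out of `ξ-row`, so ξ acts on `row n 0` as u times
      -- `row n 1`, and the recurrence for α becomes the zeroth component of `step`.
      moments : ∀ {α : ℕ → Carrier} → α 0 ≈ 1# → (∀ n → α (suc n) ≈ s * α n + ξ n (α n)) → ∀ n → α n ≈ row n 0
      moments α₀ αₛ zero    = α₀
      moments {α} α₀ αₛ (suc n) = trans (αₛ n) (+-cong (*-congˡ ih)
        (trans (+-cong (*-congˡ (θ-cong ih)) (*-congˡ ih))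
          (trans (ξ-row n 0) (solve 3 (λ u x y → u :* (y :+ con 0ℤ :* x) := u :* y) refl u (row n 0) (row n 1)))))
        where
        ih : α n ≈ row n 0
        ih = moments α₀ αₛ n

-- Two bidiagonal factorizations with nonnegative entries.

module Factorizations {c ℓ} (R : CommutativeRing c ℓ) where
  open CommutativeRing R hiding (zero)
  open IntegerSolver R
  open TotalPositivity R
  open Moments R

  module _ {n} {N : Pred Carrier n} (cone : IsCone N) where
    open IsCone cone

    #∈ : ∀ k → N (# k)
    #∈ zero    = 0∈
    #∈ (suc k) = +∈ 1∈ (#∈ k)

    1-cancel : Cancellable cone 1#
    1-cancel = resp (*-identityˡ _)

    module _ {s u ω γ ζ x y : Carrier} where

      -- Summing the increments x + 2 i y for i from 0 to k gives (k + 1) (x + k y); `C` takes the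
      -- first factor and `A` the second. The bidiagonal product then has diagonal k v + x + k y,
      -- and `E` supplies the remainder d + k e.
      lower-upper : ∀ {κ v d e} → Cancellable cone κ → N x → N y → N v → N d → N e →
        κ * γ ≈ x → κ * ζ ≈ y + y → κ * s ≈ d + x → κ * ω ≈ v + e + y → κ * u ≈ v →
        Factorization cone {subdiagonal γ ζ} {diagonal s ω} {u}
      lower-upper {κ} {v} {d} {e} κ-cancel x∈ y∈ v∈ d∈ e∈ κγ κζ κs κω κu = record
        { κ        = κ
        ; κ-cancel = κ-cancel
        ; A        = λ k → x + # k * y
        ; B        = λ k → v
        ; C        = #_
        ; E        = λ k → d + # k * e
        ; F        = λ k → 1#
        ; A∈       = λ k → +∈ x∈ (*∈ (#∈ k) y∈)
        ; B∈       = λ k → v∈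
        ; C∈       = #∈
        ; E∈       = λ k → +∈ d∈ (*∈ (#∈ k) e∈)
        ; F∈       = λ k → 1∈
        ; κg       = κsub
        ; κh₀      = trans (κdiag 0) (solve 5 (λ x y v d e →
                       con 0ℤ :* v :+ (d :+ con 0ℤ :* e :+ (x :+ con 0ℤ :* y))
                       := d :+ con 0ℤ :* e :+ con 1ℤ :* (x :+ con 0ℤ :* y)) refl x y v d e)
        ; κh       = λ k → trans (κdiag (suc k)) (solve 6 (λ k x y v d e →
                       k :* v :+ (d :+ k :* e :+ (x :+ k :* y))
                       := k :* v :+ (d :+ k :* e :+ con 1ℤ :* (x :+ k :* y))) refl (# suc k) x y v d e)
        ; κu       = λ k → trans κu (sym (*-identityˡ v))
        }
        where
        κsub : ∀ k → κ * subdiagonal γ ζ (suc k) ≈ # suc k * (x + # k * y)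
        κsub zero = trans
          (solve 3 (λ κ γ ζ → κ :* (con 0ℤ :+ (γ :+ con 0ℤ :* ζ)) := κ :* γ) refl κ γ ζ)
          (trans κγ (solve 2 (λ x y → x := (con 1ℤ :+ con 0ℤ) :* (x :+ con 0ℤ :* y)) refl x y))
        κsub (suc k) = trans
          (solve 5 (λ κ g γ k ζ → κ :* (g :+ (γ :+ k :* ζ)) := κ :* g :+ (κ :* γ :+ k :* (κ :* ζ))) refl
             κ (subdiagonal γ ζ (suc k)) γ (# suc k) ζ)
          (trans (+-cong (κsub k) (+-cong κγ (*-congˡ κζ)))
            (solve 3 (λ k x y → (con 1ℤ :+ k) :* (x :+ k :* y) :+ (x :+ (con 1ℤ :+ k) :* (y :+ y))
                             := (con 1ℤ :+ (con 1ℤ :+ k)) :* (x :+ (con 1ℤ :+ k) :* y)) refl (# k) x y))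
        κdiag : ∀ k → κ * diagonal s ω k ≈ # k * v + (d + # k * e + (x + # k * y))
        κdiag zero = trans κs (solve 5 (λ x y v d e → d :+ x :=
          con 0ℤ :* v :+ (d :+ con 0ℤ :* e :+ (x :+ con 0ℤ :* y))) refl x y v d e)
        κdiag (suc k) = trans (distribˡ κ _ ω) (trans (+-cong (κdiag k) κω)
          (solve 6 (λ k x y v d e → k :* v :+ (d :+ k :* e :+ (x :+ k :* y)) :+ (v :+ e :+ y)
            := (con 1ℤ :+ k) :* v :+ (d :+ (con 1ℤ :+ k) :* e :+ (x :+ (con 1ℤ :+ k) :* y))) refl (# k) x y v d e))

      -- For families in which s - γ has a negative coefficient, so that `lower-upper` has no
      -- nonnegative `d`. The two factors of the subdiagonal trade places: `A` carries k + 1 and `C`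
      -- the other one, now x + (k + 1) y.
      upper-lower : N x → N y → N u → γ ≈ x + y → ζ ≈ y + y → s ≈ x + u → ω ≈ y + u →
        Factorization cone {subdiagonal γ ζ} {diagonal s ω} {u}
      upper-lower x∈ y∈ u∈ γ≈ ζ≈ s≈ ω≈ = record
        { κ        = 1#
        ; κ-cancel = 1-cancel
        ; A        = λ k → # suc k
        ; B        = λ k → 1#
        ; C        = λ k → x + # k * y
        ; E        = excess
        ; F        = λ k → u
        ; A∈       = λ k → #∈ (suc k)
        ; B∈       = λ k → 1∈
        ; C∈       = λ k → +∈ x∈ (*∈ (#∈ k) y∈)
        ; E∈       = excess∈
        ; F∈       = λ k → u∈
        ; κg       = λ k → trans (*-identityˡ _) (sub k)
        ; κh₀      = trans (*-identityˡ _) (trans s≈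
                       (solve 2 (λ x u → x :+ u := x :+ u :* (con 1ℤ :+ con 0ℤ)) refl x u))
        ; κh       = λ k → trans (*-identityˡ _) (trans (diag (suc k))
                       (solve 4 (λ k x y u → x :+ k :* y :+ (con 1ℤ :+ k) :* u
                          := (x :+ k :* y) :* con 1ℤ :+ (con 0ℤ :+ u :* (con 1ℤ :+ k))) refl (# suc k) x y u))
        ; κu       = λ k → *-comm 1# u
        }
        where
        -- There is no rail before column 0, so the contribution x that `C 0` would make to the
        -- diagonal there has to come from `E`.
        excess : ℕ → Carrier
        excess zero    = x
        excess (suc k) = 0#
        excess∈ : ∀ k → N (excess k)
        excess∈ zero    = x∈
        excess∈ (suc k) = 0∈
        sub : ∀ k → subdiagonal γ ζ (suc k) ≈ (x + # suc k * y) * # suc k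
        sub zero = trans (+-congˡ (+-cong γ≈ (*-congˡ ζ≈)))
          (solve 2 (λ x y → con 0ℤ :+ (x :+ y :+ con 0ℤ :* (y :+ y))
            := (x :+ (con 1ℤ :+ con 0ℤ) :* y) :* (con 1ℤ :+ con 0ℤ)) refl x y)
        sub (suc k) = trans (+-cong (sub k) (+-cong γ≈ (*-congˡ ζ≈)))
          (solve 3 (λ k x y → (x :+ k :* y) :* k :+ (x :+ y :+ k :* (y :+ y))
            := (x :+ (con 1ℤ :+ k) :* y) :* (con 1ℤ :+ k)) refl (# suc k) x y)
        diag : ∀ k → diagonal s ω k ≈ x + # k * y + # suc k * u
        diag zero = trans s≈ (solve 3 (λ x y u → x :+ u :=
          x :+ con 0ℤ :* y :+ (con 1ℤ :+ con 0ℤ) :* u) refl x y u)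
        diag (suc k) = trans (+-cong (diag k) ω≈) (solve 4 (λ k x y u →
          x :+ k :* y :+ (con 1ℤ :+ k) :* u :+ (y :+ u)
          := x :+ (con 1ℤ :+ k) :* y :+ (con 1ℤ :+ (con 1ℤ :+ k)) :* u) refl (# k) x y u)

-- Row polynomials of a triangular array.

module RowSums {c ℓ} (R : CommutativeRing c ℓ) where
  open CommutativeRing R hiding (zero)
  open IntegerSolver R
  open import Algebra.Properties.Semiring.Exp semiring using (_^_)
  open import Relation.Binary.Reasoning.Setoid setoid
  open Moments R

  ∑ : ℕ → (ℕ → Carrier) → Carrier
  ∑ zero    f = 0#
  ∑ (suc n) f = f 0 + ∑ n (f ∘ suc)

  ∑-cong : ∀ n {f g} → (∀ k → f k ≈ g k) → ∑ n f ≈ ∑ n g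
  ∑-cong zero    f≈g = refl
  ∑-cong (suc n) f≈g = +-cong (f≈g 0) (∑-cong n (f≈g ∘ suc))

  ∑-last : ∀ n f → ∑ (suc n) f ≈ ∑ n f + f n
  ∑-last zero    f = +-comm _ _
  ∑-last (suc n) f = trans (+-congˡ (∑-last n (f ∘ suc))) (sym (+-assoc _ _ _))

  ∑-+ : ∀ n f g → ∑ n (λ k → f k + g k) ≈ ∑ n f + ∑ n g
  ∑-+ zero    f g = sym (+-identityˡ 0#)
  ∑-+ (suc n) f g = trans (+-congˡ (∑-+ n (f ∘ suc) (g ∘ suc)))
    (solve 4 (λ a b x y → (a :+ b) :+ (x :+ y) := (a :+ x) :+ (b :+ y)) refl _ _ _ _)

  ∑-* : ∀ n a f → ∑ n (λ k → a * f k) ≈ a * ∑ n f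
  ∑-* zero    a f = sym (zeroʳ a)
  ∑-* (suc n) a f = trans (+-congˡ (∑-* n a (f ∘ suc))) (sym (distribˡ a _ _))

  rowSum : Carrier → (ℕ → ℕ → Carrier) → ℕ → Carrier
  rowSum q T n = ∑ (suc n) (λ k → T n k * q ^ k)

  linear : (a b c : Carrier) → ℕ → ℕ → Carrier
  linear a b c n k = a + (# n * b + # k * c)

  -- T n k is multiplied by A n k on its way to T (n + 1) k, and by B n k on its way to T (n + 1) (k + 1).
  Recursion : (A B T : ℕ → ℕ → Carrier) → Set ℓ
  Recursion A B T = ∀ n →
      (T (suc n) 0 ≈ A n 0 * T n 0)
    × (∀ k → T (suc n) (suc k) ≈ A n (suc k) * T n (suc k) + B n k * T n k)

  Triangle : (ℕ → ℕ → Carrier) → Set ℓ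
  Triangle T = (T 0 0 ≈ 1#) × (∀ n k → n < k → T n k ≈ 0#)

  module _ {q : Carrier} (A B : ℕ → ℕ → Carrier) {T : ℕ → ℕ → Carrier}
           (triangle : Triangle T) (recursion : Recursion A B T) where

    rowSum-zero : rowSum q T 0 ≈ 1#
    rowSum-zero = trans (+-identityʳ _) (trans (*-identityʳ _) (proj₁ triangle))

    -- The sum is regrouped by the source entry `T n k`, which feeds columns k and k + 1 of the next
    -- row. The one surplus term contains `T n (suc n)`, which is zero by triangularity.
    rowSum-suc : ∀ n → rowSum q T (suc n) ≈ ∑ (suc n) (λ k → (A n k + B n k * q) * (T n k * q ^ k))
    rowSum-suc n = begin
      T (suc n) 0 * 1# + ∑ (suc n) (λ k → T (suc n) (suc k) * (q * q ^ k))
        ≈⟨ +-cong (*-congʳ (proj₁ (recursion n))) (∑-cong (suc n) (λ k → trans (*-congʳ (proj₂ (recursion n) k))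
             (solve 6 (λ a b t t′ q p → (a :* t :+ b :* t′) :* (q :* p) := a :* (t :* (q :* p)) :+ b :* q :* (t′ :* p))
                refl (A n (suc k)) (B n k) (T n (suc k)) (T n k) q (q ^ k)))) ⟩
      A n 0 * T n 0 * 1# + ∑ (suc n) (λ k → α (suc k) + β k)
        ≈⟨ +-cong (*-assoc _ _ _) (∑-+ (suc n) (α ∘ suc) β) ⟩
      α 0 + (∑ (suc n) (α ∘ suc) + ∑ (suc n) β)
        ≈⟨ +-assoc _ _ _ ⟨
      ∑ (suc (suc n)) α + ∑ (suc n) β
        ≈⟨ +-congʳ (trans (∑-last (suc n) α) (trans (+-congˡ last≈0) (+-identityʳ _))) ⟩
      ∑ (suc n) α + ∑ (suc n) β
        ≈⟨ ∑-+ (suc n) α β ⟨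
      ∑ (suc n) (λ k → α k + β k)
        ≈⟨ ∑-cong (suc n) (λ k → sym (distribʳ (T n k * q ^ k) (A n k) (B n k * q))) ⟩
      ∑ (suc n) (λ k → (A n k + B n k * q) * (T n k * q ^ k)) ∎
      where
      α β : ℕ → Carrier
      α k = A n k * (T n k * q ^ k)
      β k = B n k * q * (T n k * q ^ k)
      last≈0 : α (suc n) ≈ 0#
      last≈0 = trans (*-congˡ (trans (*-congʳ (proj₂ triangle n (suc n) ℕ.≤-refl)) (zeroˡ _))) (zeroʳ _)

  module _ {θ : Carrier → Carrier} (derivation : IsDerivation θ) where
    open IsDerivation derivation

    Constant : Carrier → Set ℓ
    Constant x = θ x ≈ 0#

    constant-+ : ∀ {x y} → Constant x → Constant y → Constant (x + y)
    constant-+ x′ y′ = trans (θ-+ _ _) (trans (+-cong x′ y′) (+-identityˡ 0#))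

    constant-* : ∀ {x y} → Constant x → Constant y → Constant (x * y)
    constant-* {x} {y} x′ y′ = trans (θ-* x y) (trans (+-cong (*-congʳ x′) (*-congˡ y′))
      (solve 2 (λ x y → con 0ℤ :* y :+ x :* con 0ℤ := con 0ℤ) refl x y))

    constant-neg : ∀ {x} → Constant x → Constant (- x)
    constant-neg {x} x′ = begin
      θ (- x)          ≈⟨ trans (+-congʳ x′) (+-identityˡ _) ⟨
      θ x + θ (- x)    ≈⟨ θ-+ x (- x) ⟨
      θ (x + - x)      ≈⟨ θ-cong (-‿inverseʳ x) ⟩
      θ 0#             ≈⟨ θ-0 ⟩
      0#               ∎

    constant-linear : ∀ {a b c} → Constant a → Constant b → Constant c → ∀ n k → Constant (linear a b c n k)
    constant-linear a′ b′ c′ n k = constant-+ a′ (constant-+ (constant-* (θ-# n) b′) (constant-* (θ-# k) c′))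

    module _ (A B : ℕ → ℕ → Carrier) {T : ℕ → ℕ → Carrier} (triangle : Triangle T) (recursion : Recursion A B T)
             (A′ : ∀ n k → Constant (A n k)) (B′ : ∀ n k → Constant (B n k)) where

      constant-T : ∀ n k → Constant (T n k)
      constant-T zero    zero    = trans (θ-cong (proj₁ triangle)) θ-1
      constant-T zero    (suc k) = trans (θ-cong (proj₂ triangle 0 (suc k) (ℕ.s≤s ℕ.z≤n))) θ-0
      constant-T (suc n) zero    = trans (θ-cong (proj₁ (recursion n))) (constant-* (A′ n 0) (constant-T n 0))
      constant-T (suc n) (suc k) = trans (θ-cong (proj₂ (recursion n) k))
        (constant-+ (constant-* (A′ n (suc k)) (constant-T n (suc k))) (constant-* (B′ n k) (constant-T n k)))

      module _ {q : Carrier} (θq : θ q ≈ q) where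

        θ-^ : ∀ k → θ (q ^ k) ≈ # k * q ^ k
        θ-^ zero    = trans θ-1 (sym (zeroˡ _))
        θ-^ (suc k) = trans (θ-* q (q ^ k)) (trans (+-cong (*-congʳ θq) (*-congˡ (θ-^ k)))
          (solve 3 (λ q k p → q :* p :+ q :* (k :* p) := (con 1ℤ :+ k) :* (q :* p)) refl q (# k) (q ^ k)))

        θ-∑ : ∀ n f → θ (∑ n f) ≈ ∑ n (θ ∘ f)
        θ-∑ zero    f = θ-0
        θ-∑ (suc n) f = trans (θ-+ _ _) (+-congˡ (θ-∑ n (f ∘ suc)))

        θ-rowSum : ∀ n → θ (rowSum q T n) ≈ ∑ (suc n) (λ k → # k * (T n k * q ^ k))
        θ-rowSum n = trans (θ-∑ (suc n) (λ k → T n k * q ^ k)) (∑-cong (suc n) (λ k → trans (θ-* (T n k) (q ^ k))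
          (trans (+-cong (*-congʳ (constant-T n k)) (*-congˡ (θ-^ k)))
            (solve 3 (λ t k p → con 0ℤ :* p :+ t :* (k :* p) := k :* (t :* p)) refl (T n k) (# k) (q ^ k)))))

-- Hankel positivity from syntactic data of a recurrence.

module Recurrences {c ℓ} (R : CommutativeRing c ℓ) where
  open CommutativeRing R hiding (zero)
  open IntegerSolver R
  open AlternatingForm R
  open LogConvexity R
  open Factorizations R
  open import Relation.Binary.Reasoning.Setoid setoid
  open TotalPositivity R
  open Moments R hiding (ξ)
  open RowSums R

  module _ {n} {N : Pred Carrier n} (cone : IsCone N) where
    open IsCone cone

    HankelPositive : (ℕ → Carrier) → Set n
    HankelPositive α = ∀ {rs js} → Strict 0 rs → Strict 0 js → N (hankelMinor rs α js)

    module _ {θ : Carrier → Carrier} (derivation : IsDerivation θ) {q : Carrier} (θq : θ q ≈ q) where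
      open IsDerivation derivation

      constant-fromℤ : ∀ i → Constant derivation (fromℤ i)
      constant-fromℤ (ℤ.+ n)      = constant-fromℕ n
        where
        open import Algebra.Properties.Semiring.Mult.TCOptimised semiring renaming (_×_ to _·_; 1+× to 1+·)
        constant-fromℕ : ∀ n → Constant derivation (n · 1#)
        constant-fromℕ zero    = θ-0
        constant-fromℕ (suc n) = trans (θ-cong (1+· n 1#)) (constant-+ derivation θ-1 (constant-fromℕ n))
      constant-fromℤ ℤ.-[1+ n ]   = constant-neg derivation (constant-fromℤ (ℤ.+ suc n))

      module Families {m} (ρ : Vec Carrier m) (ρ-constant : ∀ i → Constant derivation (lookup ρ i)) where

        Expr : Set
        Expr = Polynomial (suc m)

        Q : Expr
        Q = var zero

        ⟪_⟫ : Expr → Carrier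
        ⟪ p ⟫ = ⟦ p ⟧ (q ∷ ρ)

        weaken : Polynomial m → Expr
        weaken (op o p r) = op o (weaken p) (weaken r)
        weaken (con i)    = con i
        weaken (var i)    = var (suc i)
        weaken (p :^ k)   = weaken p :^ k
        weaken (:- p)     = :- weaken p

        constant-weaken : ∀ p → Constant derivation ⟪ weaken p ⟫
        constant-weaken (op [+] p r) = constant-+ derivation (constant-weaken p) (constant-weaken r)
        constant-weaken (op [*] p r) = constant-* derivation (constant-weaken p) (constant-weaken r)
        constant-weaken (con i)      = constant-fromℤ i
        constant-weaken (var i)      = ρ-constant i
        constant-weaken (p :^ 0)     = θ-1
        constant-weaken (p :^ suc k) = constant-* derivation (constant-weaken p) (constant-weaken (p :^ k))
        constant-weaken (:- p)       = constant-neg derivation (constant-weaken p)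

        -- On a concrete expression this computes to a product of unit types, which Agda fills in by
        -- itself; hence it can be an implicit argument of the factorization lemmas.
        Nonneg : Expr → Set
        Nonneg (op o p r)       = Nonneg p × Nonneg r
        Nonneg (con (ℤ.+ _))    = ⊤
        Nonneg (con ℤ.-[1+ _ ]) = ⊥
        Nonneg (var i)          = ⊤
        Nonneg (p :^ k)         = Nonneg p
        Nonneg (:- p)           = ⊥

        -- A homogeneous linear form in p and q at p = 1. Neither coefficient involves q, so θ keeps
        -- exactly the `slope`.
        record Affine : Set where
          constructor _+_·q
          field
            coeff₀ coeff₁ : Polynomial m

          slope expr : Expr
          slope = weaken coeff₁ :* Q
          expr  = weaken coeff₀ :+ slope
        open Affine

        θ-affine : ∀ f → θ ⟪ expr f ⟫ ≈ ⟪ slope f ⟫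
        θ-affine (f₀ + f₁ ·q) = trans (θ-+ _ _) (trans (+-cong (constant-weaken f₀)
            (trans (θ-* _ q) (+-cong (*-congʳ (constant-weaken f₁)) (*-congˡ θq))))
          (solve 2 (λ f q → con 0ℤ :+ (con 0ℤ :* q :+ f :* q) := f :* q) refl ⟪ weaken f₁ ⟫ q))

        infix 4 _≐_
        -- With the two expressions as record parameters they remain inferable, and
        -- `normalised refl` asks the type checker to compare their normal forms.
        record _≐_ (p r : Expr) : Set ℓ where
          constructor normalised
          field
            equation : ⟦ p ⟧↓ (q ∷ ρ) ≈ ⟦ r ⟧↓ (q ∷ ρ)

          evaluated : ⟪ p ⟫ ≈ ⟪ r ⟫
          evaluated = prove (q ∷ ρ) p r equation
        open _≐_

        record Family : Set ℓ where
          field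
            s η κ u ω γ ζ : Affine

          ξ : Affine → Expr
          ξ f = expr κ :* slope f :+ expr η :* expr f

          field
            ξu : ξ u :+ expr u :* expr u ≐ expr u :* expr ω
            ξs : ξ s ≐ expr u :* expr γ
            ξω : ξ ω ≐ expr u :* expr ζ
            ξγ : ξ γ ≐ expr u :* expr γ
            ξζ : ξ ζ ≐ expr u :* expr ζ

        module _ (family : Family) where
          open Family family

          -- Since θ multiplies qᵏ by k, the operator s + n η + κ θ acts on the term of index k as s
          -- + n η + k κ. The part of this without q stays in column k, the part with q moves to
          -- column k + 1.
          A B : ℕ → ℕ → Carrier
          A = linear ⟪ weaken (coeff₀ s) ⟫ ⟪ weaken (coeff₀ η) ⟫ ⟪ weaken (coeff₀ κ) ⟫
          B = linear ⟪ weaken (coeff₁ s) ⟫ ⟪ weaken (coeff₁ η) ⟫ ⟪ weaken (coeff₁ κ) ⟫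

          open Tridiagonal (subdiagonal ⟪ expr γ ⟫ ⟪ expr ζ ⟫) (diagonal ⟪ expr s ⟫ ⟪ expr ω ⟫) ⟪ expr u ⟫ using (row)

          module _ {T : ℕ → ℕ → Carrier} (triangle : Triangle T) (recursion : Recursion A B T) where

            rowSum-next : ∀ n → rowSum q T (suc n) ≈
              ⟪ expr s ⟫ * rowSum q T n + (⟪ expr κ ⟫ * θ (rowSum q T n) + # n * ⟪ expr η ⟫ * rowSum q T n)
            rowSum-next n = begin
              rowSum q T (suc n)
                ≈⟨ rowSum-suc A B triangle recursion n ⟩
              ∑ (suc n) (λ k → (A n k + B n k * q) * τ k)
                ≈⟨ ∑-cong (suc n) (λ k → solve 10 (λ a b c a′ b′ c′ q n k t →
                     (a :+ (n :* b :+ k :* c) :+ (a′ :+ (n :* b′ :+ k :* c′)) :* q) :* t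
                     := (a :+ a′ :* q :+ n :* (b :+ b′ :* q)) :* t :+ (c :+ c′ :* q) :* (k :* t)) refl
                     ⟪ weaken (coeff₀ s) ⟫ ⟪ weaken (coeff₀ η) ⟫ ⟪ weaken (coeff₀ κ) ⟫
                     ⟪ weaken (coeff₁ s) ⟫ ⟪ weaken (coeff₁ η) ⟫ ⟪ weaken (coeff₁ κ) ⟫ q (# n) (# k) (τ k)) ⟩
              ∑ (suc n) (λ k → (⟪ expr s ⟫ + # n * ⟪ expr η ⟫) * τ k + ⟪ expr κ ⟫ * (# k * τ k))
                ≈⟨ trans (∑-+ (suc n) (λ k → (⟪ expr s ⟫ + # n * ⟪ expr η ⟫) * τ k) (λ k → ⟪ expr κ ⟫ * (# k * τ k)))
                     (+-cong (∑-* (suc n) _ τ) (∑-* (suc n) ⟪ expr κ ⟫ (λ k → # k * τ k))) ⟩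
              (⟪ expr s ⟫ + # n * ⟪ expr η ⟫) * rowSum q T n + ⟪ expr κ ⟫ * ∑ (suc n) (λ k → # k * τ k)
                ≈⟨ +-congˡ (*-congˡ (sym (θ-rowSum derivation A B triangle recursion
                     (constant-linear derivation (constant-weaken (coeff₀ s)) (constant-weaken (coeff₀ η)) (constant-weaken (coeff₀ κ)))
                     (constant-linear derivation (constant-weaken (coeff₁ s)) (constant-weaken (coeff₁ η)) (constant-weaken (coeff₁ κ)))
                     θq n))) ⟩
              (⟪ expr s ⟫ + # n * ⟪ expr η ⟫) * rowSum q T n + ⟪ expr κ ⟫ * θ (rowSum q T n)
                ≈⟨ solve 4 (λ s e r d → (s :+ e) :* r :+ d := s :* r :+ (d :+ e :* r)) refl
                     ⟪ expr s ⟫ (# n * ⟪ expr η ⟫) (rowSum q T n) _ ⟩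
              ⟪ expr s ⟫ * rowSum q T n + (⟪ expr κ ⟫ * θ (rowSum q T n) + # n * ⟪ expr η ⟫ * rowSum q T n) ∎
              where
              open import Algebra.Properties.Semiring.Exp semiring
              τ : ℕ → Carrier
              τ k = T n k * q ^ k

            rowSum≈row : ∀ n → rowSum q T n ≈ row n 0
            rowSum≈row = moments derivation ⟪ expr κ ⟫ ⟪ expr η ⟫ ⟪ expr s ⟫ ⟪ expr u ⟫ ⟪ expr ω ⟫ ⟪ expr γ ⟫ ⟪ expr ζ ⟫
              (trans (+-congʳ (derive u)) (evaluated ξu))
              (trans (derive s) (evaluated ξs)) (trans (derive ω) (evaluated ξω))
              (trans (derive γ) (evaluated ξγ)) (trans (derive ζ) (evaluated ξζ))
              (rowSum-zero {q} A B triangle recursion) rowSum-next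
              where
              derive : ∀ f → ⟪ expr κ ⟫ * θ ⟪ expr f ⟫ + ⟪ expr η ⟫ * ⟪ expr f ⟫ ≈ ⟪ ξ f ⟫
              derive f = +-congʳ (*-congˡ (θ-affine f))

            rowSum-hankelPositive :
              Factorization cone {subdiagonal ⟪ expr γ ⟫ ⟪ expr ζ ⟫} {diagonal ⟪ expr s ⟫ ⟪ expr ω ⟫} {⟪ expr u ⟫} →
              HankelPositive (rowSum q T)
            rowSum-hankelPositive factorization {rs} {js} rs< js< =
              resp (sym (form-map-cong (minor-isForm rs) (λ j i → rowSum≈row (i ℕ.+ j)) js))
                   (hankel-positive cone factorization rs< js<)

          module _ (q∈ : N q) (ρ∈ : ∀ i → N (lookup ρ i)) where

            nonneg∈ : ∀ p → Nonneg p → N ⟪ p ⟫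
            nonneg∈ (op [+] p r) (p≥0 , r≥0) = +∈ (nonneg∈ p p≥0) (nonneg∈ r r≥0)
            nonneg∈ (op [*] p r) (p≥0 , r≥0) = *∈ (nonneg∈ p p≥0) (nonneg∈ r r≥0)
            nonneg∈ (con (ℤ.+ k)) _          = fromℕ∈ k
              where
              open import Algebra.Properties.Semiring.Mult.TCOptimised semiring renaming (_×_ to _·_; 1+× to 1+·)
              fromℕ∈ : ∀ k → N (k · 1#)
              fromℕ∈ zero    = 0∈
              fromℕ∈ (suc k) = resp (sym (1+· k 1#)) (+∈ 1∈ (fromℕ∈ k))
            nonneg∈ (var zero)    _          = q∈
            nonneg∈ (var (suc i)) _          = ρ∈ i
            nonneg∈ (p :^ 0)      _          = 1∈
            nonneg∈ (p :^ suc k)  p≥0        = *∈ (nonneg∈ p p≥0) (nonneg∈ (p :^ k) p≥0)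

            family-lower-upper : ∀ k (x y v d e : Expr) {_ : Nonneg (x :+ (y :+ (v :+ (d :+ e))))} →
              Cancellable cone (fromℤ k) →
              con k :* expr γ ≐ x → con k :* expr ζ ≐ y :+ y → con k :* expr s ≐ d :+ x →
              con k :* expr ω ≐ v :+ e :+ y → con k :* expr u ≐ v →
              Factorization cone {subdiagonal ⟪ expr γ ⟫ ⟪ expr ζ ⟫} {diagonal ⟪ expr s ⟫ ⟪ expr ω ⟫} {⟪ expr u ⟫}
            family-lower-upper k x y v d e {x≥0 , y≥0 , v≥0 , d≥0 , e≥0} k-cancel kγ kζ ks kω ku =
              lower-upper cone k-cancel (nonneg∈ x x≥0) (nonneg∈ y y≥0) (nonneg∈ v v≥0) (nonneg∈ d d≥0) (nonneg∈ e e≥0)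
                (evaluated kγ) (evaluated kζ) (evaluated ks) (evaluated kω) (evaluated ku)

            family-upper-lower : ∀ (x y : Expr) {_ : Nonneg (x :+ (y :+ expr u))} →
              expr γ ≐ x :+ y → expr ζ ≐ y :+ y → expr s ≐ x :+ expr u → expr ω ≐ y :+ expr u →
              Factorization cone {subdiagonal ⟪ expr γ ⟫ ⟪ expr ζ ⟫} {diagonal ⟪ expr s ⟫ ⟪ expr ω ⟫} {⟪ expr u ⟫}
            family-upper-lower x y {x≥0 , y≥0 , u≥0} γ≐ ζ≐ s≐ ω≐ =
              upper-lower cone (nonneg∈ x x≥0) (nonneg∈ y y≥0) (nonneg∈ (expr u) u≥0)
                (evaluated γ≐) (evaluated ζ≐) (evaluated s≐) (evaluated ω≐)

-- The individual recurrences.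

module Cases {c ℓ} (R : CommutativeRing c ℓ) where
  open CommutativeRing R hiding (zero)
  open IntegerSolver R
  open Factorizations R
  open TotalPositivity R
  open Moments R hiding (ξ)
  open RowSums R
  open Recurrences R

  record Setting {n} {N : Pred Carrier n} (cone : IsCone N) {θ : Carrier → Carrier} (derivation : IsDerivation θ) :
                 Set (c ⊔ ℓ ⊔ n) where
    field
      a₀ a₁ a₂ b₀ b₁ b₂ q a₁⁻¹ : Carrier
      ι              : ℤ → Carrier
      a₀∈            : N a₀
      a₁∈            : N a₁
      a₂∈            : N a₂
      b₀∈            : N b₀
      b₁∈            : N b₁
      b₂∈            : N b₂
      q∈             : N q
      a₁⁻¹∈          : N a₁⁻¹
      a₀-constant    : Constant derivation a₀
      a₁-constant    : Constant derivation a₁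
      a₂-constant    : Constant derivation a₂
      b₀-constant    : Constant derivation b₀
      b₁-constant    : Constant derivation b₁
      b₂-constant    : Constant derivation b₂
      a₁⁻¹-constant  : Constant derivation a₁⁻¹
      θq             : θ q ≈ q
      a₁*a₁⁻¹        : a₁ * a₁⁻¹ ≈ 1#
      2-cancel       : Cancellable cone (1# + 1#)
      ι-+            : ∀ i j → ι (i ℤ.+ j) ≈ ι i + ι j
      ι-*            : ∀ i j → ι (i ℤ.* j) ≈ ι i * ι j
      ι-neg          : ∀ i → ι (ℤ.- i) ≈ - ι i
      ι-ℕ            : ∀ k → ι (ℤ.+ k) ≈ # k

  module _ {n} {N : Pred Carrier n} {cone : IsCone N} {θ : Carrier → Carrier} {derivation : IsDerivation θ}
           (setting : Setting cone derivation) where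
    open Setting setting
    open IsCone cone

    private
      -- As a variable of its own, a₂ / a₁ makes (vi) and (vii) polynomial: (2 a₂ - a₁) / a₁ is 2 μ
      -- - 1 and a₂ is μ a₁.
      μ : Carrier
      μ = a₂ * a₁⁻¹

      ρ : Vec Carrier 7
      ρ = a₀ ∷ a₁ ∷ a₂ ∷ b₀ ∷ b₁ ∷ b₂ ∷ μ ∷ []

      ρ-constant : ∀ i → Constant derivation (lookup ρ i)
      ρ-constant 0F = a₀-constant
      ρ-constant 1F = a₁-constant
      ρ-constant 2F = a₂-constant
      ρ-constant 3F = b₀-constant
      ρ-constant 4F = b₁-constant
      ρ-constant 5F = b₂-constant
      ρ-constant 6F = constant-* derivation a₂-constant a₁⁻¹-constant

      ρ∈ : ∀ i → N (lookup ρ i)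
      ρ∈ 0F = a₀∈
      ρ∈ 1F = a₁∈
      ρ∈ 2F = a₂∈
      ρ∈ 3F = b₀∈
      ρ∈ 4F = b₁∈
      ρ∈ 5F = b₂∈
      ρ∈ 6F = *∈ a₂∈ a₁⁻¹∈

    open Families cone derivation θq ρ ρ-constant
    open Affine

    private
      a₀ᵖ a₁ᵖ a₂ᵖ b₀ᵖ b₁ᵖ b₂ᵖ μᵖ 0ᵖ : Polynomial 7
      a₀ᵖ = var 0F
      a₁ᵖ = var 1F
      a₂ᵖ = var 2F
      b₀ᵖ = var 3F
      b₁ᵖ = var 4F
      b₂ᵖ = var 5F
      μᵖ  = var 6F
      0ᵖ  = con 0ℤ

      2·_ : Polynomial 7 → Polynomial 7
      2· p = p :+ p

    private
      -- Here ξ₁ is multiplication by u.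
      familyᵢ : Family
      familyᵢ = record
        { s = a₂ᵖ + b₂ᵖ ·q ; η = a₀ᵖ + b₀ᵖ ·q ; κ = 0ᵖ + 0ᵖ ·q
        ; u = a₀ᵖ + b₀ᵖ ·q ; ω = (2· a₀ᵖ) + (2· b₀ᵖ) ·q ; γ = a₂ᵖ + b₂ᵖ ·q ; ζ = (2· a₀ᵖ) + (2· b₀ᵖ) ·q
        ; ξu = normalised refl ; ξs = normalised refl ; ξω = normalised refl ; ξγ = normalised refl ; ξζ = normalised refl
        }

      -- The forms s, κ and u are all multiples of a₀ + q, and ξ₁ (a₀ + q) = (a₀ + q) u.
      familyᵢᵢ : Family
      familyᵢᵢ = record
        { s = (a₀ᵖ :* b₂ᵖ) + b₂ᵖ ·q ; η = (a₀ᵖ :* (b₀ᵖ :+ b₁ᵖ)) + b₀ᵖ ·q ; κ = (a₀ᵖ :* b₁ᵖ) + b₁ᵖ ·q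
        ; u = (a₀ᵖ :* (b₀ᵖ :+ b₁ᵖ)) + (b₀ᵖ :+ b₁ᵖ) ·q ; ω = (2· (a₀ᵖ :* (b₀ᵖ :+ b₁ᵖ))) + (2· (b₀ᵖ :+ b₁ᵖ)) ·q ; γ = (a₀ᵖ :* b₂ᵖ) + b₂ᵖ ·q ; ζ = (2· (a₀ᵖ :* (b₀ᵖ :+ b₁ᵖ))) + (2· (b₀ᵖ :+ b₁ᵖ)) ·q
        ; ξu = normalised refl ; ξs = normalised refl ; ξω = normalised refl ; ξγ = normalised refl ; ξζ = normalised refl
        }

      -- Here ξ₁ = u θ, so ξ₁ of an affine form is u times its slope.
      familyᵢᵢᵢ : Family
      familyᵢᵢᵢ = record
        { s = a₂ᵖ + b₂ᵖ ·q ; η = 0ᵖ + 0ᵖ ·q ; κ = a₁ᵖ + b₁ᵖ ·q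
        ; u = a₁ᵖ + b₁ᵖ ·q ; ω = a₁ᵖ + (2· b₁ᵖ) ·q ; γ = 0ᵖ + b₂ᵖ ·q ; ζ = 0ᵖ + (2· b₁ᵖ) ·q
        ; ξu = normalised refl ; ξs = normalised refl ; ξω = normalised refl ; ξγ = normalised refl ; ξζ = normalised refl
        }

      -- Since ξ₁ 1 = u and ξ₁ q = 0, ξ₁ of an affine form is u times its constant coefficient.
      familyᵢᵥ : Family
      familyᵢᵥ = record
        { s = a₂ᵖ + b₂ᵖ ·q ; η = a₀ᵖ + b₀ᵖ ·q ; κ = (:- a₀ᵖ) + (:- b₀ᵖ) ·q
        ; u = a₀ᵖ + b₀ᵖ ·q ; ω = (2· a₀ᵖ) + b₀ᵖ ·q ; γ = a₂ᵖ + 0ᵖ ·q ; ζ = (2· a₀ᵖ) + 0ᵖ ·q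
        ; ξu = normalised refl ; ξs = normalised refl ; ξω = normalised refl ; ξγ = normalised refl ; ξζ = normalised refl
        }

      -- The families v₁ to v₄ are (v) with a₂ = 0, b₂ = 0, a₂ = a₁ and b₂ = b₀.
      familyᵥ₁ : Family
      familyᵥ₁ = record
        { s = 0ᵖ + b₂ᵖ ·q ; η = 0ᵖ + b₀ᵖ ·q ; κ = a₁ᵖ + (:- b₀ᵖ) ·q
        ; u = a₁ᵖ + 0ᵖ ·q ; ω = a₁ᵖ + b₀ᵖ ·q ; γ = 0ᵖ + b₂ᵖ ·q ; ζ = 0ᵖ + (2· b₀ᵖ) ·q
        ; ξu = normalised refl ; ξs = normalised refl ; ξω = normalised refl ; ξγ = normalised refl ; ξζ = normalised refl
        }

      familyᵥ₂ : Family
      familyᵥ₂ = record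
        { s = a₂ᵖ + 0ᵖ ·q ; η = 0ᵖ + b₀ᵖ ·q ; κ = a₁ᵖ + (:- b₀ᵖ) ·q
        ; u = 0ᵖ + b₀ᵖ ·q ; ω = a₁ᵖ + b₀ᵖ ·q ; γ = a₂ᵖ + 0ᵖ ·q ; ζ = (2· a₁ᵖ) + 0ᵖ ·q
        ; ξu = normalised refl ; ξs = normalised refl ; ξω = normalised refl ; ξγ = normalised refl ; ξζ = normalised refl
        }

      familyᵥ₃ : Family
      familyᵥ₃ = record
        { s = a₁ᵖ + b₂ᵖ ·q ; η = 0ᵖ + b₀ᵖ ·q ; κ = a₁ᵖ + (:- b₀ᵖ) ·q
        ; u = a₁ᵖ + 0ᵖ ·q ; ω = a₁ᵖ + b₀ᵖ ·q ; γ = 0ᵖ + (b₂ᵖ :+ b₀ᵖ) ·q ; ζ = 0ᵖ + (2· b₀ᵖ) ·q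
        ; ξu = normalised refl ; ξs = normalised refl ; ξω = normalised refl ; ξγ = normalised refl ; ξζ = normalised refl
        }

      familyᵥ₄ : Family
      familyᵥ₄ = record
        { s = a₂ᵖ + b₀ᵖ ·q ; η = 0ᵖ + b₀ᵖ ·q ; κ = a₁ᵖ + (:- b₀ᵖ) ·q
        ; u = 0ᵖ + b₀ᵖ ·q ; ω = a₁ᵖ + b₀ᵖ ·q ; γ = (a₂ᵖ :+ a₁ᵖ) + 0ᵖ ·q ; ζ = (2· a₁ᵖ) + 0ᵖ ·q
        ; ξu = normalised refl ; ξs = normalised refl ; ξω = normalised refl ; ξγ = normalised refl ; ξζ = normalised refl
        }

      -- From ξ₁ 1 = b₀ + a₁ q and ξ₁ q = - b₀ q it follows that ω = 2 b₀ + a₁ q satisfies ξ₁ ω = u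
      -- ω. The remaining forms are s = γ = μ ω and ζ = ω.
      familyᵥᵢ : Family
      familyᵥᵢ = record
        { s = (b₀ᵖ :* (2· μᵖ)) + (μᵖ :* a₁ᵖ) ·q ; η = b₀ᵖ + a₁ᵖ ·q ; κ = (:- (2· b₀ᵖ)) + (:- a₁ᵖ) ·q
        ; u = b₀ᵖ + 0ᵖ ·q ; ω = (2· b₀ᵖ) + a₁ᵖ ·q ; γ = (b₀ᵖ :* (2· μᵖ)) + (μᵖ :* a₁ᵖ) ·q ; ζ = (2· b₀ᵖ) + a₁ᵖ ·q
        ; ξu = normalised refl ; ξs = normalised refl ; ξω = normalised refl ; ξγ = normalised refl ; ξζ = normalised refl
        }

      -- The case (vi) with the two homogeneous variables exchanged.
      familyᵥᵢᵢ : Family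
      familyᵥᵢᵢ = record
        { s = (μᵖ :* a₁ᵖ) + (b₀ᵖ :* (2· μᵖ)) ·q ; η = 0ᵖ + (:- b₀ᵖ) ·q ; κ = a₁ᵖ + (2· b₀ᵖ) ·q
        ; u = 0ᵖ + b₀ᵖ ·q ; ω = a₁ᵖ + (2· b₀ᵖ) ·q ; γ = (μᵖ :* a₁ᵖ) + (b₀ᵖ :* (2· μᵖ)) ·q ; ζ = a₁ᵖ + (2· b₀ᵖ) ·q
        ; ξu = normalised refl ; ξs = normalised refl ; ξω = normalised refl ; ξγ = normalised refl ; ξζ = normalised refl
        }

    ι-- : ∀ i j → ι (i ℤ.- j) ≈ ι i + - ι j
    ι-- i j = trans (ι-+ i (ℤ.- j)) (+-congˡ (ι-neg j))

    ι-n-k : ∀ n k → ι (ℤ.+ n ℤ.- ℤ.+ k) ≈ # n + - # k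
    ι-n-k n k = trans (ι-- (ℤ.+ n) (ℤ.+ k)) (+-cong (ι-ℕ n) (-‿cong (ι-ℕ k)))

    ι-2k : ∀ k → ι (ℤ.+ 2 ℤ.* ℤ.+ k) ≈ # 2 * # k
    ι-2k k = trans (ι-* (ℤ.+ 2) (ℤ.+ k)) (*-cong (ι-ℕ 2) (ι-ℕ k))

    recursion-cong : ∀ {A A′ B B′ T} → (∀ n k → A n k ≈ A′ n k) → (∀ n k → B n k ≈ B′ n k) →
                     Recursion A B T → Recursion A′ B′ T
    recursion-cong A≈ B≈ recursion n with recursion n
    ... | T₀ , Tₛ = trans T₀ (*-congʳ (A≈ n 0))
                  , λ k → trans (Tₛ k) (+-cong (*-congʳ (A≈ n (suc k))) (*-congʳ (B≈ n k)))

    private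
      expand-μ : ∀ x → b₀ * (x + (ι (ℤ.+ 2) * a₂ + - a₁) * a₁⁻¹) ≈ b₀ * (x + (μ + μ + - 1#))
      expand-μ x = trans (*-congˡ (+-congˡ (*-congʳ (+-congʳ (*-congʳ (ι-ℕ 2))))))
        (trans (solve 5 (λ b x a₂ a₁ i →
                  b :* (x :+ ((con 1ℤ :+ (con 1ℤ :+ con 0ℤ)) :* a₂ :+ :- a₁) :* i)
                  := b :* (x :+ (a₂ :* i :+ a₂ :* i :+ :- (a₁ :* i)))) refl b₀ x a₂ a₁ a₁⁻¹)
               (*-congˡ (+-congˡ (+-congˡ (-‿cong a₁*a₁⁻¹)))))

      a₂≈μ*a₁ : a₂ ≈ μ * a₁
      a₂≈μ*a₁ = sym (trans (solve 3 (λ a i b → a :* i :* b := a :* (b :* i)) refl a₂ a₁⁻¹ a₁)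
        (trans (*-congˡ a₁*a₁⁻¹) (*-identityʳ a₂)))

    module _ {T : ℕ → ℕ → Carrier} (triangle : Triangle T) where

      hankelPositiveᵢ : Recursion (λ n k → a₀ * ι (ℤ.+ suc n ℤ.- 1ℤ) + a₂)
        (λ n k → b₀ * ι (ℤ.+ suc n ℤ.- 1ℤ) + b₂) T → HankelPositive cone (rowSum q T)
      hankelPositiveᵢ recursion = rowSum-hankelPositive familyᵢ triangle
        (recursion-cong
          -- `+ suc n - 1ℤ` computes to `+ n`, the index of the source row, so `ι-ℕ n` applies
          -- directly.
          (λ n k → trans (+-congʳ (*-congˡ (ι-ℕ n))) (solve 4 (λ a b n k → a :* n :+ b := b :+ (n :* a :+ k :* con 0ℤ)) refl a₀ a₂ (# n) (# k)))
          (λ n k → trans (+-congʳ (*-congˡ (ι-ℕ n))) (solve 4 (λ a b n k → a :* n :+ b := b :+ (n :* a :+ k :* con 0ℤ)) refl b₀ b₂ (# n) (# k))) recursion)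
        (family-lower-upper familyᵢ q∈ ρ∈ 1ℤ (expr (Family.s familyᵢ)) (expr (Family.u familyᵢ)) (expr (Family.u familyᵢ)) (con 0ℤ) (con 0ℤ) (1-cancel cone)
        (normalised refl) (normalised refl) (normalised refl) (normalised refl) (normalised refl))

      hankelPositiveᵢᵢ : Recursion (λ n k → a₀ * (b₀ + b₁) * ι (ℤ.+ suc n ℤ.- 1ℤ) + a₀ * b₁ * ι (ℤ.+ k) + a₀ * b₂)
        (λ n k → b₀ * ι (ℤ.+ suc n ℤ.- 1ℤ) + b₁ * ι (ℤ.+ suc k ℤ.- 1ℤ) + b₂) T → HankelPositive cone (rowSum q T)
      hankelPositiveᵢᵢ recursion = rowSum-hankelPositive familyᵢᵢ triangle
        (recursion-cong
          (λ n k → trans (+-congʳ (+-cong (*-congˡ (ι-ℕ n)) (*-congˡ (ι-ℕ k))))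
          (solve 6 (λ a b₀ b₁ b₂ n k → a :* (b₀ :+ b₁) :* n :+ a :* b₁ :* k :+ a :* b₂
             := a :* b₂ :+ (n :* (a :* (b₀ :+ b₁)) :+ k :* (a :* b₁))) refl a₀ b₀ b₁ b₂ (# n) (# k)))
          (λ n k → trans (+-congʳ (+-cong (*-congˡ (ι-ℕ n)) (*-congˡ (ι-ℕ k))))
          (solve 5 (λ b₀ b₁ b₂ n k → b₀ :* n :+ b₁ :* k :+ b₂ := b₂ :+ (n :* b₀ :+ k :* b₁)) refl b₀ b₁ b₂ (# n) (# k))) recursion)
        (family-lower-upper familyᵢᵢ q∈ ρ∈ 1ℤ (expr (Family.s familyᵢᵢ)) (expr (Family.u familyᵢᵢ)) (expr (Family.u familyᵢᵢ)) (con 0ℤ) (con 0ℤ) (1-cancel cone)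
        (normalised refl) (normalised refl) (normalised refl) (normalised refl) (normalised refl))

      hankelPositiveᵢᵢᵢ : Recursion (λ n k → a₁ * ι (ℤ.+ k) + a₂)
        (λ n k → b₁ * ι (ℤ.+ suc k ℤ.- 1ℤ) + b₂) T → HankelPositive cone (rowSum q T)
      hankelPositiveᵢᵢᵢ recursion = rowSum-hankelPositive familyᵢᵢᵢ triangle
        (recursion-cong
          (λ n k → trans (+-congʳ (*-congˡ (ι-ℕ k))) (solve 4 (λ a b n k → a :* k :+ b := b :+ (n :* con 0ℤ :+ k :* a)) refl a₁ a₂ (# n) (# k)))
          (λ n k → trans (+-congʳ (*-congˡ (ι-ℕ k))) (solve 4 (λ a b n k → a :* k :+ b := b :+ (n :* con 0ℤ :+ k :* a)) refl b₁ b₂ (# n) (# k))) recursion)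
        (family-lower-upper familyᵢᵢᵢ q∈ ρ∈ 1ℤ (weaken b₂ᵖ :* Q) (weaken b₁ᵖ :* Q) (expr (Family.u familyᵢᵢᵢ)) (weaken a₂ᵖ) (con 0ℤ) (1-cancel cone)
        (normalised refl) (normalised refl) (normalised refl) (normalised refl) (normalised refl))

      hankelPositiveᵢᵥ : Recursion (λ n k → a₀ * ι (ℤ.+ suc n ℤ.- ℤ.+ k ℤ.- 1ℤ) + a₂)
        (λ n k → b₀ * ι (ℤ.+ suc n ℤ.- ℤ.+ suc k) + b₂) T → HankelPositive cone (rowSum q T)
      hankelPositiveᵢᵥ recursion = rowSum-hankelPositive familyᵢᵥ triangle
        (recursion-cong
          (λ n k → trans (+-congʳ (*-congˡ (trans (ι-- (ℤ.+ suc n ℤ.- ℤ.+ k) 1ℤ) (+-cong (ι-n-k (suc n) k) (-‿cong (ι-ℕ 1))))))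
          (solve 4 (λ a b n k → a :* (con 1ℤ :+ n :+ :- k :+ :- (con 1ℤ :+ con 0ℤ)) :+ b := b :+ (n :* a :+ k :* (:- a))) refl a₀ a₂ (# n) (# k)))
          (λ n k → trans (+-congʳ (*-congˡ (ι-n-k (suc n) (suc k))))
          (solve 4 (λ a b n k → a :* (con 1ℤ :+ n :+ :- (con 1ℤ :+ k)) :+ b := b :+ (n :* a :+ k :* (:- a))) refl b₀ b₂ (# n) (# k))) recursion)
        (family-lower-upper familyᵢᵥ q∈ ρ∈ 1ℤ (weaken a₂ᵖ) (weaken a₀ᵖ) (expr (Family.u familyᵢᵥ)) (weaken b₂ᵖ :* Q) (con 0ℤ) (1-cancel cone)
        (normalised refl) (normalised refl) (normalised refl) (normalised refl) (normalised refl))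

      private
        Aᵥ≈ : ∀ α n k → a₁ * ι (ℤ.+ k) + α ≈ linear α 0# a₁ n k
        Aᵥ≈ α n k = trans (+-congʳ (*-congˡ (ι-ℕ k)))
          (solve 4 (λ a b n k → a :* k :+ b := b :+ (n :* con 0ℤ :+ k :* a)) refl a₁ α (# n) (# k))

        Bᵥ≈ : ∀ β n k → b₀ * ι (ℤ.+ suc n) + - (b₀ * ι (ℤ.+ suc k)) + β ≈ linear β b₀ (- b₀) n k
        Bᵥ≈ β n k = trans (+-congʳ (+-cong (*-congˡ (ι-ℕ (suc n))) (-‿cong (*-congˡ (ι-ℕ (suc k))))))
          (solve 4 (λ a b n k → a :* (con 1ℤ :+ n) :+ :- (a :* (con 1ℤ :+ k)) :+ b := b :+ (n :* a :+ k :* (:- a)))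
             refl b₀ β (# n) (# k))

      hankelPositiveᵥ₁ : Recursion (λ n k → a₁ * ι (ℤ.+ k) + 0#)
        (λ n k → b₀ * ι (ℤ.+ suc n) + - (b₀ * ι (ℤ.+ suc k)) + b₂) T → HankelPositive cone (rowSum q T)
      hankelPositiveᵥ₁ recursion = rowSum-hankelPositive familyᵥ₁ triangle
        (recursion-cong
          (λ n k → Aᵥ≈ 0# n k)
          (λ n k → Bᵥ≈ b₂ n k) recursion)
        (family-lower-upper familyᵥ₁ q∈ ρ∈ 1ℤ (weaken b₂ᵖ :* Q) (weaken b₀ᵖ :* Q) (weaken a₁ᵖ) (con 0ℤ) (con 0ℤ) (1-cancel cone)
        (normalised refl) (normalised refl) (normalised refl) (normalised refl) (normalised refl))

      hankelPositiveᵥ₂ : Recursion (λ n k → a₁ * ι (ℤ.+ k) + a₂)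
        (λ n k → b₀ * ι (ℤ.+ suc n) + - (b₀ * ι (ℤ.+ suc k)) + 0#) T → HankelPositive cone (rowSum q T)
      hankelPositiveᵥ₂ recursion = rowSum-hankelPositive familyᵥ₂ triangle
        (recursion-cong
          (λ n k → Aᵥ≈ a₂ n k)
          (λ n k → Bᵥ≈ 0# n k) recursion)
        (family-lower-upper familyᵥ₂ q∈ ρ∈ 1ℤ (weaken a₂ᵖ) (weaken a₁ᵖ) (weaken b₀ᵖ :* Q) (con 0ℤ) (con 0ℤ) (1-cancel cone)
        (normalised refl) (normalised refl) (normalised refl) (normalised refl) (normalised refl))

      hankelPositiveᵥ₃ : Recursion (λ n k → a₁ * ι (ℤ.+ k) + a₁)
        (λ n k → b₀ * ι (ℤ.+ suc n) + - (b₀ * ι (ℤ.+ suc k)) + b₂) T → HankelPositive cone (rowSum q T)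
      hankelPositiveᵥ₃ recursion = rowSum-hankelPositive familyᵥ₃ triangle
        (recursion-cong
          (λ n k → Aᵥ≈ a₁ n k)
          (λ n k → Bᵥ≈ b₂ n k) recursion)
        (family-upper-lower familyᵥ₃ q∈ ρ∈ (weaken b₂ᵖ :* Q) (weaken b₀ᵖ :* Q) (normalised refl) (normalised refl) (normalised refl) (normalised refl))

      hankelPositiveᵥ₄ : Recursion (λ n k → a₁ * ι (ℤ.+ k) + a₂)
        (λ n k → b₀ * ι (ℤ.+ suc n) + - (b₀ * ι (ℤ.+ suc k)) + b₀) T → HankelPositive cone (rowSum q T)
      hankelPositiveᵥ₄ recursion = rowSum-hankelPositive familyᵥ₄ triangle
        (recursion-cong
          (λ n k → Aᵥ≈ a₂ n k)
          (λ n k → Bᵥ≈ b₀ n k) recursion)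
        (family-upper-lower familyᵥ₄ q∈ ρ∈ (weaken a₂ᵖ) (weaken a₁ᵖ) (normalised refl) (normalised refl) (normalised refl) (normalised refl))

      hankelPositiveᵥᵢ : Recursion (λ n k → b₀ * (ι (ℤ.+ suc n ℤ.- ℤ.+ 2 ℤ.* ℤ.+ k) + (ι (ℤ.+ 2) * a₂ + - a₁) * a₁⁻¹))
        (λ n k → a₁ * ι (ℤ.+ suc n ℤ.- ℤ.+ suc k) + a₂) T → HankelPositive cone (rowSum q T)
      hankelPositiveᵥᵢ recursion = rowSum-hankelPositive familyᵥᵢ triangle
        (recursion-cong
          (λ n k → trans (expand-μ _) (trans (*-congˡ (+-congʳ (trans (ι-- (ℤ.+ suc n) (ℤ.+ 2 ℤ.* ℤ.+ k)) (+-cong (ι-ℕ (suc n)) (-‿cong (ι-2k k))))))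
          (solve 4 (λ b m n k → b :* (con 1ℤ :+ n :+ :- ((con 1ℤ :+ (con 1ℤ :+ con 0ℤ)) :* k) :+ (m :+ m :+ :- con 1ℤ))
             := b :* (m :+ m) :+ (n :* b :+ k :* (:- (b :+ b)))) refl b₀ μ (# n) (# k))))
          (λ n k → trans (+-cong (*-congˡ (ι-n-k (suc n) (suc k))) a₂≈μ*a₁)
          (solve 4 (λ a b n k → a :* (con 1ℤ :+ n :+ :- (con 1ℤ :+ k)) :+ b := b :+ (n :* a :+ k :* (:- a))) refl a₁ (μ * a₁) (# n) (# k))) recursion)
        -- After doubling, 2 ζ = ω + ω gives y = ω and 2 γ gives x. The diagonal slope 2 ω = 2 b₀ +
        -- a₁ q + ω then leaves e = a₁ q beside v = 2 u and y.
        (family-lower-upper familyᵥᵢ q∈ ρ∈ (ℤ.+ 2) (weaken (b₀ᵖ :* (2· μᵖ)) :+ weaken (b₀ᵖ :* (2· μᵖ)) :+ (weaken (μᵖ :* a₁ᵖ) :+ weaken (μᵖ :* a₁ᵖ)) :* Q) (expr (Family.ω familyᵥᵢ)) (weaken (2· b₀ᵖ)) (con 0ℤ) (weaken a₁ᵖ :* Q) 2-cancel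
        (normalised refl) (normalised refl) (normalised refl) (normalised refl) (normalised refl))

      hankelPositiveᵥᵢᵢ : Recursion (λ n k → a₁ * ι (ℤ.+ k) + a₂)
        (λ n k → b₀ * (ι (ℤ.+ 2 ℤ.* ℤ.+ suc k ℤ.- ℤ.+ suc n) + (ι (ℤ.+ 2) * a₂ + - a₁) * a₁⁻¹)) T → HankelPositive cone (rowSum q T)
      hankelPositiveᵥᵢᵢ recursion = rowSum-hankelPositive familyᵥᵢᵢ triangle
        (recursion-cong
          (λ n k → trans (+-cong (*-congˡ (ι-ℕ k)) a₂≈μ*a₁) (solve 4 (λ a b n k → a :* k :+ b := b :+ (n :* con 0ℤ :+ k :* a)) refl a₁ (μ * a₁) (# n) (# k)))
          (λ n k → trans (expand-μ _) (trans (*-congˡ (+-congʳ (trans (ι-- (ℤ.+ 2 ℤ.* ℤ.+ suc k) (ℤ.+ suc n)) (+-cong (ι-2k (suc k)) (-‿cong (ι-ℕ (suc n)))))))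
          (solve 4 (λ b m n k → b :* ((con 1ℤ :+ (con 1ℤ :+ con 0ℤ)) :* (con 1ℤ :+ k) :+ :- (con 1ℤ :+ n) :+ (m :+ m :+ :- con 1ℤ))
             := b :* (m :+ m) :+ (n :* (:- b) :+ k :* (b :+ b))) refl b₀ μ (# n) (# k)))) recursion)
        (family-lower-upper familyᵥᵢᵢ q∈ ρ∈ (ℤ.+ 2) (weaken (μᵖ :* a₁ᵖ) :+ weaken (μᵖ :* a₁ᵖ) :+ (weaken (b₀ᵖ :* (2· μᵖ)) :+ weaken (b₀ᵖ :* (2· μᵖ))) :* Q) (expr (Family.ω familyᵥᵢᵢ)) (weaken (2· b₀ᵖ) :* Q) (con 0ℤ) (weaken a₁ᵖ) 2-cancel
        (normalised refl) (normalised refl) (normalised refl) (normalised refl) (normalised refl))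

-- Integer Laurent polynomials as a commutative ring.

open import Defs
open ≡ using (refl; sym; trans; cong; cong₂; subst; module ≡-Reasoning)

infixl 6 _·_ _⁻·_

_·_ _⁻·_ : Mon → Mon → Mon
m · n  = zipWith ℤ._+_ m n
m ⁻· n = zipWith (λ i j → j ℤ.- i) m n

⁻·-· : ∀ {k} (m n : Vec ℤ k) → zipWith (λ i j → j ℤ.- i) m (zipWith ℤ._+_ m n) ≡ n
⁻·-· Vec.[] Vec.[] = refl
⁻·-· (i Vec.∷ m) (j Vec.∷ n) = cong₂ Vec._∷_ (i+j-i≡j i j) (⁻·-· m n)
  where
  i+j-i≡j : ∀ i j → i ℤ.+ j ℤ.- i ≡ j
  i+j-i≡j = solve-∀

·-⁻· : ∀ {k} (m n : Vec ℤ k) → zipWith ℤ._+_ m (zipWith (λ i j → j ℤ.- i) m n) ≡ n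
·-⁻· Vec.[] Vec.[] = refl
·-⁻· (i Vec.∷ m) (j Vec.∷ n) = cong₂ Vec._∷_ (i+[j-i]≡j i j) (·-⁻· m n)
  where
  i+[j-i]≡j : ∀ i j → i ℤ.+ (j ℤ.- i) ≡ j
  i+[j-i]≡j = solve-∀

·-identityˡ : ∀ m → zeroMon · m ≡ m
·-identityˡ = zipWith-identityˡ ℤ.+-identityˡ

coeff-++ : ∀ p r k → coeff (p ++ r) k ≡ coeff p k ℤ.+ coeff r k
coeff-++ []            r k = sym (ℤ.+-identityˡ _)
coeff-++ ((c , m) ∷ p) r k with m ≟ₘ k
... | yes _ = trans (cong (λ z → c ℤ.+ z) (coeff-++ p r k)) (sym (ℤ.+-assoc c _ _))
... | no _  = coeff-++ p r k

coeff-neg : ∀ p k → coeff (neg p) k ≡ ℤ.- coeff p k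
coeff-neg []            k = refl
coeff-neg ((c , m) ∷ p) k with m ≟ₘ k
... | yes _ = trans (cong (λ z → ℤ.- c ℤ.+ z) (coeff-neg p k)) (sym (ℤ.neg-distrib-+ c _))
... | no _  = coeff-neg p k

-- Laurent monomials are invertible, so multiplying by one merely shifts the coefficient function,
-- with no case distinction on divisibility.
coeff-single-⊗ : ∀ c m r k → coeff ([ (c , m) ] ⊗ r) k ≡ c ℤ.* coeff r (m ⁻· k)
coeff-single-⊗ c m []            k = sym (ℤ.*-zeroʳ c)
coeff-single-⊗ c m ((d , n) ∷ r) k with (m · n) ≟ₘ k | n ≟ₘ (m ⁻· k)
... | yes _    | yes _ = trans (cong (λ z → c ℤ.* d ℤ.+ z) (coeff-single-⊗ c m r k)) (sym (ℤ.*-distribˡ-+ c d _))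
... | no _     | no _  = coeff-single-⊗ c m r k
... | yes refl | no n≢ = contradiction (sym (⁻·-· m n)) n≢
... | no ≢k    | yes refl = contradiction (·-⁻· m k) ≢k

infix 4 _≋_

-- Unlike _≈_, this relation determines the two polynomials it is about.
record _≋_ (p r : Poly) : Set where
  constructor pointwise
  field
    at : p ≈ r
open _≋_

≋-refl : ∀ {p} → p ≋ p
≋-refl = pointwise (λ _ → refl)

≋-trans : ∀ {p r s} → p ≋ r → r ≋ s → p ≋ s
≋-trans p≈r r≈s = pointwise (λ k → trans (at p≈r k) (at r≈s k))

≋-sym : ∀ {p r} → p ≋ r → r ≋ p
≋-sym p≈r = pointwise (λ k → sym (at p≈r k))

≡⇒≋ : ∀ {p r} → p ≡ r → p ≋ r
≡⇒≋ refl = ≋-refl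

⊕-cong : ∀ {p p′ r r′} → p ≋ p′ → r ≋ r′ → p ⊕ r ≋ p′ ⊕ r′
⊕-cong {p} {p′} {r} {r′} p≈ r≈ = pointwise (λ k →
  trans (coeff-++ p r k) (trans (cong₂ ℤ._+_ (at p≈ k) (at r≈ k)) (sym (coeff-++ p′ r′ k))))

⊕-comm : ∀ p r → p ⊕ r ≋ r ⊕ p
⊕-comm p r = pointwise (λ k →
  trans (coeff-++ p r k) (trans (ℤ.+-comm (coeff p k) _) (sym (coeff-++ r p k))))

+-interchange : ∀ a b c d → (a ℤ.+ b) ℤ.+ (c ℤ.+ d) ≡ (a ℤ.+ c) ℤ.+ (b ℤ.+ d)
+-interchange = solve-∀

⊕-interchange : ∀ p r s t → (p ⊕ r) ⊕ (s ⊕ t) ≋ (p ⊕ s) ⊕ (r ⊕ t)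
⊕-interchange p r s t = pointwise go
  where
  go : (p ⊕ r) ⊕ (s ⊕ t) ≈ (p ⊕ s) ⊕ (r ⊕ t)
  go k
    rewrite coeff-++ (p ⊕ r) (s ⊕ t) k | coeff-++ (p ⊕ s) (r ⊕ t) k
          | coeff-++ p r k | coeff-++ s t k | coeff-++ p s k | coeff-++ r t k =
    +-interchange (coeff p k) (coeff r k) (coeff s k) (coeff t k)

∷-⊗ : ∀ x p r → (x ∷ p) ⊗ r ≡ ([ x ] ⊗ r) ⊕ (p ⊗ r)
∷-⊗ (c , m) p r = cong (_++ (p ⊗ r)) (sym (++-identityʳ _))

single-⊗-distribˡ : ∀ x r s → [ x ] ⊗ (r ⊕ s) ≡ ([ x ] ⊗ r) ⊕ ([ x ] ⊗ s)
single-⊗-distribˡ (c , m) []      s = refl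
single-⊗-distribˡ (c , m) (y ∷ r) s = cong (_ ∷_) (single-⊗-distribˡ (c , m) r s)

⊗-distribʳ : ∀ s p r → (p ⊕ r) ⊗ s ≡ (p ⊗ s) ⊕ (r ⊗ s)
⊗-distribʳ s []      r = refl
⊗-distribʳ s (x ∷ p) r = begin
  (x ∷ p ⊕ r) ⊗ s                        ≡⟨ ∷-⊗ x (p ⊕ r) s ⟩
  ([ x ] ⊗ s) ⊕ ((p ⊕ r) ⊗ s)            ≡⟨ cong (([ x ] ⊗ s) ⊕_) (⊗-distribʳ s p r) ⟩
  ([ x ] ⊗ s) ⊕ ((p ⊗ s) ⊕ (r ⊗ s))      ≡⟨ ++-assoc ([ x ] ⊗ s) (p ⊗ s) (r ⊗ s) ⟨
  ([ x ] ⊗ s) ⊕ (p ⊗ s) ⊕ (r ⊗ s)        ≡⟨ cong (_⊕ (r ⊗ s)) (∷-⊗ x p s) ⟨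
  ((x ∷ p) ⊗ s) ⊕ (r ⊗ s)                ∎
  where open ≡-Reasoning

⊗-distribˡ : ∀ p r s → p ⊗ (r ⊕ s) ≋ (p ⊗ r) ⊕ (p ⊗ s)
⊗-distribˡ []      r s = ≋-refl
⊗-distribˡ (x ∷ p) r s = ≋-trans (≡⇒≋ (∷-⊗ x p (r ⊕ s)))
  (≋-trans (⊕-cong (≡⇒≋ (single-⊗-distribˡ x r s)) (⊗-distribˡ p r s))
  (≋-trans (⊕-interchange ([ x ] ⊗ r) ([ x ] ⊗ s) (p ⊗ r) (p ⊗ s))
           (⊕-cong (≡⇒≋ (sym (∷-⊗ x p r))) (≡⇒≋ (sym (∷-⊗ x p s))))))

⊗-zeroʳ : ∀ p → p ⊗ 𝟘 ≡ 𝟘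
⊗-zeroʳ []      = refl
⊗-zeroʳ (x ∷ p) = ⊗-zeroʳ p

single-⊗-comm : ∀ x r → [ x ] ⊗ r ≋ r ⊗ [ x ]
single-⊗-comm x       []            = ≋-refl
single-⊗-comm (c , m) ((d , n) ∷ r) = ⊕-cong {[ _ ]} {[ _ ]}
  (≡⇒≋ (cong [_] (cong₂ _,_ (ℤ.*-comm c d) (zipWith-comm ℤ.+-comm m n)))) (single-⊗-comm (c , m) r)

⊗-comm : ∀ p r → p ⊗ r ≋ r ⊗ p
⊗-comm []      r = ≡⇒≋ (sym (⊗-zeroʳ r))
⊗-comm (x ∷ p) r = ≋-trans (≡⇒≋ (∷-⊗ x p r))
  (≋-trans (⊕-cong (single-⊗-comm x r) (⊗-comm p r)) (≋-sym (⊗-distribˡ r [ x ] p)))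

-- Equal polynomials may be quite different lists, so the proof recurses on the fixed factor and
-- uses `coeff-single-⊗`, where only the coefficients of `r` enter. The other argument is reached by
-- commutativity.
⊗-congˡ : ∀ p {r r′} → r ≋ r′ → p ⊗ r ≋ p ⊗ r′
⊗-congˡ []            r≈ = ≋-refl
⊗-congˡ ((c , m) ∷ p) {r} {r′} r≈ = ≋-trans (≡⇒≋ (∷-⊗ (c , m) p r))
  (≋-trans (⊕-cong (pointwise (λ k → trans (coeff-single-⊗ c m r k)
                     (trans (cong (c ℤ.*_) (at r≈ (m ⁻· k))) (sym (coeff-single-⊗ c m r′ k)))))
                   (⊗-congˡ p r≈))
           (≡⇒≋ (sym (∷-⊗ (c , m) p r′))))

⊗-cong : ∀ {p p′ r r′} → p ≋ p′ → r ≋ r′ → p ⊗ r ≋ p′ ⊗ r′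
⊗-cong {p} {p′} {r} {r′} p≈ r≈ = ≋-trans (⊗-congˡ p r≈)
  (≋-trans (⊗-comm p r′) (≋-trans (⊗-congˡ r′ p≈) (⊗-comm r′ p′)))

single-⊗-single-assoc : ∀ x y s → ([ x ] ⊗ [ y ]) ⊗ s ≡ [ x ] ⊗ ([ y ] ⊗ s)
single-⊗-single-assoc x y [] = refl
single-⊗-single-assoc x@(c , m) y@(d , n) ((e , l) ∷ s) = cong₂ _∷_
  (cong₂ _,_ (ℤ.*-assoc c d e) (zipWith-assoc ℤ.+-assoc m n l)) (single-⊗-single-assoc x y s)

single-⊗-assoc : ∀ x r s → ([ x ] ⊗ r) ⊗ s ≡ [ x ] ⊗ (r ⊗ s)
single-⊗-assoc x []      s = refl
single-⊗-assoc x (y ∷ r) s = begin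
  ([ x ] ⊗ (y ∷ r)) ⊗ s                          ≡⟨ cong (_⊗ s) (single-⊗-distribˡ x [ y ] r) ⟩
  (([ x ] ⊗ [ y ]) ⊕ ([ x ] ⊗ r)) ⊗ s            ≡⟨ ⊗-distribʳ s ([ x ] ⊗ [ y ]) ([ x ] ⊗ r) ⟩
  (([ x ] ⊗ [ y ]) ⊗ s) ⊕ (([ x ] ⊗ r) ⊗ s)      ≡⟨ cong₂ _⊕_ (single-⊗-single-assoc x y s) (single-⊗-assoc x r s) ⟩
  ([ x ] ⊗ ([ y ] ⊗ s)) ⊕ ([ x ] ⊗ (r ⊗ s))      ≡⟨ single-⊗-distribˡ x ([ y ] ⊗ s) (r ⊗ s) ⟨
  [ x ] ⊗ (([ y ] ⊗ s) ⊕ (r ⊗ s))                ≡⟨ cong ([ x ] ⊗_) (∷-⊗ y r s) ⟨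
  [ x ] ⊗ ((y ∷ r) ⊗ s)                          ∎
  where open ≡-Reasoning

⊗-assoc : ∀ p r s → (p ⊗ r) ⊗ s ≡ p ⊗ (r ⊗ s)
⊗-assoc []      r s = refl
⊗-assoc (x ∷ p) r s = begin
  ((x ∷ p) ⊗ r) ⊗ s                      ≡⟨ cong (_⊗ s) (∷-⊗ x p r) ⟩
  (([ x ] ⊗ r) ⊕ (p ⊗ r)) ⊗ s            ≡⟨ ⊗-distribʳ s ([ x ] ⊗ r) (p ⊗ r) ⟩
  (([ x ] ⊗ r) ⊗ s) ⊕ ((p ⊗ r) ⊗ s)      ≡⟨ cong₂ _⊕_ (single-⊗-assoc x r s) (⊗-assoc p r s) ⟩
  ([ x ] ⊗ (r ⊗ s)) ⊕ (p ⊗ (r ⊗ s))      ≡⟨ ∷-⊗ x p (r ⊗ s) ⟨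
  (x ∷ p) ⊗ (r ⊗ s)                      ∎
  where open ≡-Reasoning

⊗-identityˡ : ∀ p → 𝟙 ⊗ p ≡ p
⊗-identityˡ []            = refl
⊗-identityˡ ((c , m) ∷ p) = cong₂ _∷_ (cong₂ _,_ (ℤ.*-identityˡ c) (·-identityˡ m)) (⊗-identityˡ p)

⊕-inverseʳ : ∀ p → p ⊕ neg p ≋ 𝟘
⊕-inverseʳ p = pointwise (λ k →
  trans (coeff-++ p (neg p) k) (trans (cong (λ z → coeff p k ℤ.+ z) (coeff-neg p k)) (ℤ.+-inverseʳ (coeff p k))))

polyRing : CommutativeRing 0ℓ 0ℓ
polyRing = record
  { Carrier = Poly
  ; _≈_ = _≋_
  ; _+_ = _⊕_
  ; _*_ = _⊗_
  ; -_  = neg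
  ; 0#  = 𝟘
  ; 1#  = 𝟙
  ; isCommutativeRing = record
    { isRing = record
      { +-isAbelianGroup = record
        { isGroup = record
          { isMonoid = record
            { isSemigroup = record
              { isMagma = record
                { isEquivalence = record
                  { refl  = ≋-refl
                  ; sym   = ≋-sym
                  ; trans = ≋-trans
                  }
                ; ∙-cong = ⊕-cong
                }
              ; assoc = λ p r s → ≡⇒≋ (++-assoc p r s)
              }
            ; identity = (λ _ → ≋-refl) , λ p → ≡⇒≋ (++-identityʳ p)
            }
          ; inverse = (λ p → ≋-trans (⊕-comm (neg p) p) (⊕-inverseʳ p)) , ⊕-inverseʳ
          ; ⁻¹-cong = λ {p} {r} p≈r → pointwise (λ k →
              trans (coeff-neg p k) (trans (cong ℤ.-_ (at p≈r k)) (sym (coeff-neg r k))))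
          }
        ; comm = ⊕-comm
        }
      ; *-cong     = ⊗-cong
      ; *-assoc    = λ p r s → ≡⇒≋ (⊗-assoc p r s)
      ; *-identity = (λ p → ≡⇒≋ (⊗-identityˡ p)) , λ p → ≋-trans (⊗-comm p 𝟙) (≡⇒≋ (⊗-identityˡ p))
      ; distrib    = ⊗-distribˡ , λ s p r → ≡⇒≋ (⊗-distribʳ s p r)
      }
    ; *-comm = ⊗-comm
    }
  }

-- The derivation q d/dq.

θ : Poly → Poly
θ []            = []
θ ((c , m) ∷ p) = (c ℤ.* lookup m 6F , m) ∷ θ p

coeff-θ : ∀ p k → coeff (θ p) k ≡ coeff p k ℤ.* lookup k 6F
coeff-θ []            k = sym (ℤ.*-zeroˡ (lookup k 6F))
coeff-θ ((c , m) ∷ p) k with m ≟ₘ k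
... | yes refl = trans (cong (λ z → c ℤ.* lookup m 6F ℤ.+ z) (coeff-θ p k)) (sym (ℤ.*-distribʳ-+ (lookup m 6F) c _))
... | no _     = coeff-θ p k

θ-⊕ : ∀ p r → θ (p ⊕ r) ≡ θ p ⊕ θ r
θ-⊕ []      r = refl
θ-⊕ (x ∷ p) r = cong (_ ∷_) (θ-⊕ p r)

coeff-split : ∀ c d m p r → (c ℤ.+ d , m) ∷ (p ⊕ r) ≈ ((c , m) ∷ p) ⊕ ((d , m) ∷ r)
coeff-split c d m p r k rewrite coeff-++ ((c , m) ∷ p) ((d , m) ∷ r) k with m ≟ₘ k
... | yes _ = trans (cong (λ z → c ℤ.+ d ℤ.+ z) (coeff-++ p r k)) (+-interchange c d (coeff p k) (coeff r k))
... | no _  = coeff-++ p r k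

θ-single-⊗ : ∀ x r → θ ([ x ] ⊗ r) ≋ (θ [ x ] ⊗ r) ⊕ ([ x ] ⊗ θ r)
θ-single-⊗ x [] = ≋-refl
θ-single-⊗ (c , m) ((d , n) ∷ r) = ≋-trans
  (⊕-cong {[ _ ]} {[ (c ℤ.* lookup m 6F) ℤ.* d ℤ.+ c ℤ.* (d ℤ.* lookup n 6F) , m · n ]}
     (≡⇒≋ (cong (λ i → [ (i , m · n) ])
       (trans (cong (c ℤ.* d ℤ.*_) (lookup-zipWith ℤ._+_ 6F m n)) (leibniz c d (lookup m 6F) (lookup n 6F)))))
     (θ-single-⊗ (c , m) r))
  (pointwise (coeff-split _ _ (m · n) (θ [ (c , m) ] ⊗ r) ([ (c , m) ] ⊗ θ r)))
  where
  leibniz : ∀ c d i j → c ℤ.* d ℤ.* (i ℤ.+ j) ≡ c ℤ.* i ℤ.* d ℤ.+ c ℤ.* (d ℤ.* j)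
  leibniz = solve-∀

θ-⊗ : ∀ p r → θ (p ⊗ r) ≋ (θ p ⊗ r) ⊕ (p ⊗ θ r)
θ-⊗ []      r = ≋-refl
θ-⊗ (x@(c , m) ∷ p) r = begin
  θ ((x ∷ p) ⊗ r)                                              ≡⟨ cong θ (∷-⊗ x p r) ⟩
  θ (([ x ] ⊗ r) ⊕ (p ⊗ r))                                    ≡⟨ θ-⊕ ([ x ] ⊗ r) (p ⊗ r) ⟩
  θ ([ x ] ⊗ r) ⊕ θ (p ⊗ r)                                    ≈⟨ ⊕-cong (θ-single-⊗ x r) (θ-⊗ p r) ⟩
  ((θ [ x ] ⊗ r) ⊕ ([ x ] ⊗ θ r)) ⊕ ((θ p ⊗ r) ⊕ (p ⊗ θ r))    ≈⟨ ⊕-interchange (θ [ x ] ⊗ r) ([ x ] ⊗ θ r) (θ p ⊗ r) (p ⊗ θ r) ⟩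
  ((θ [ x ] ⊗ r) ⊕ (θ p ⊗ r)) ⊕ (([ x ] ⊗ θ r) ⊕ (p ⊗ θ r))    ≡⟨ cong₂ _⊕_ (∷-⊗ (c ℤ.* lookup m 6F , m) (θ p) r) (∷-⊗ x p (θ r)) ⟨
  (θ (x ∷ p) ⊗ r) ⊕ ((x ∷ p) ⊗ θ r)                            ∎
  where open import Relation.Binary.Reasoning.Setoid (CommutativeRing.setoid polyRing)

θ-cong : ∀ {p r} → p ≋ r → θ p ≋ θ r
θ-cong {p} {r} p≈r = pointwise (λ k →
  trans (coeff-θ p k) (trans (cong (ℤ._* lookup k 6F) (at p≈r k)) (sym (coeff-θ r k))))

open _≋_

module Poly = CommutativeRing polyRing
open IntegerSolver polyRing using (solve; _:*_; _:+_; :-_; _:=_; con)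
open AlternatingForm polyRing
open TotalPositivity polyRing
open Moments polyRing using (#_; IsDerivation)
open LogConvexity polyRing
open RowSums polyRing using (∑; rowSum; Triangle)
open Recurrences polyRing using (HankelPositive)
open Cases polyRing
open import Algebra.Properties.Semiring.Exp Poly.semiring using (_^_)
open import Relation.Binary.Reasoning.Setoid Poly.setoid

θ-isDerivation : IsDerivation θ
θ-isDerivation = record { θ-cong = θ-cong ; θ-+ = λ p r → ≡⇒≋ (θ-⊕ p r) ; θ-* = θ-⊗ }

ι-+ : ∀ i j → ι (i ℤ.+ j) ≋ ι i ⊕ ι j
ι-+ i j = pointwise (coeff-split i j zeroMon [] [])

ι-* : ∀ i j → ι (i ℤ.* j) ≋ ι i ⊗ ι j
ι-* i j = ≋-refl

ι-ℕ : ∀ k → ι (+ k) ≋ # k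
ι-ℕ zero    = pointwise (λ k → ι0 k)
  where
  ι0 : ι 0ℤ ≈ 𝟘
  ι0 k with zeroMon ≟ₘ k
  ... | yes _ = refl
  ... | no _  = refl
ι-ℕ (suc k) = ≋-trans (ι-+ 1ℤ (+ k)) (⊕-cong ≋-refl (ι-ℕ k))

-- The cone of nonnegative polynomials.

-- A condition on the listed terms is preserved by products term by term; a condition on
-- coefficients would have to be followed through a convolution.
GoodTerm : ℤ × Mon → Set
GoodTerm (c , m) = 0ℤ ℤ.≤ c × (∀ i → ¬ i ≡ 1F → 0ℤ ℤ.≤ lookup m i)

-- Up to a positive integer factor, p is a sum of monomials satisfying NonNeg: the
-- denominators make the cone closed under division by 2.
Positive : Poly → Set
Positive p = ∃₂ λ t r → ι (+ suc t) ⊗ p ≋ r × All GoodTerm r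

0≤+ : ∀ {i j} → 0ℤ ℤ.≤ i → 0ℤ ℤ.≤ j → 0ℤ ℤ.≤ i ℤ.+ j
0≤+ = ℤ.+-mono-≤

0≤* : ∀ {i j} → 0ℤ ℤ.≤ i → 0ℤ ℤ.≤ j → 0ℤ ℤ.≤ i ℤ.* j
0≤* {+ m} {+ n} _ _ = subst (0ℤ ℤ.≤_) (ℤ.pos-* m n) (ℤ.+≤+ z≤n)

good-single-⊗ : ∀ {x r} → GoodTerm x → All GoodTerm r → All GoodTerm ([ x ] ⊗ r)
good-single-⊗ x≥0 []            = []
good-single-⊗ {c , m} {(d , n) ∷ r} x≥0@(c≥0 , m≥0) ((d≥0 , n≥0) ∷ r≥0) =
  (0≤* c≥0 d≥0 , λ i i≢1 → subst (0ℤ ℤ.≤_) (sym (lookup-zipWith ℤ._+_ i m n)) (0≤+ (m≥0 i i≢1) (n≥0 i i≢1)))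
  ∷ good-single-⊗ x≥0 r≥0

good-⊗ : ∀ {p r} → All GoodTerm p → All GoodTerm r → All GoodTerm (p ⊗ r)
good-⊗ [] r≥0 = []
good-⊗ {x ∷ p} {r} (x≥0 ∷ p≥0) r≥0 =
  subst (All GoodTerm) (sym (∷-⊗ x p r)) (++⁺ (good-single-⊗ x≥0 r≥0) (good-⊗ p≥0 r≥0))

good-ι : ∀ n → All GoodTerm (ι (+ n))
good-ι n = (ℤ.+≤+ z≤n , zero≥0) ∷ []
  where
  zero≥0 : ∀ i → ¬ i ≡ 1F → 0ℤ ℤ.≤ lookup zeroMon i
  zero≥0 i _ = ℤ.≤-reflexive (sym (lookup∘tabulate (λ _ → 0ℤ) i))

good⇒positive : ∀ p → All GoodTerm p → Positive p
good⇒positive p p≥0 = 0 , p , Poly.*-identityˡ p , p≥0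

positive-isCone : IsCone Positive
positive-isCone = record
  { resp = λ { p≋r (t , s , tp≋s , s≥0) → t , s , ≋-trans (Poly.*-congˡ {ι (+ suc t)} (≋-sym p≋r)) tp≋s , s≥0 }
  ; 0∈   = good⇒positive 𝟘 []
  ; 1∈   = good⇒positive 𝟙 (good-ι 1)
  ; +∈   = λ { {p} {r} (t , s , tp≋s , s≥0) (t′ , s′ , tr≋s′ , s′≥0) →
      t′ ℕ.+ t ℕ.* suc t′ , (ι (+ suc t′) ⊗ s) ⊕ (ι (+ suc t) ⊗ s′)
    , ≋-trans (Poly.*-congʳ {p ⊕ r} (scalar-* t t′))
        (≋-trans (solve 4 (λ t t′ p r → t :* t′ :* (p :+ r) := t′ :* (t :* p) :+ t :* (t′ :* r)) ≋-refl
                    (ι (+ suc t)) (ι (+ suc t′)) p r)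
                 (⊕-cong (Poly.*-congˡ {ι (+ suc t′)} tp≋s) (Poly.*-congˡ {ι (+ suc t)} tr≋s′)))
    , ++⁺ (good-⊗ (good-ι (suc t′)) s≥0) (good-⊗ (good-ι (suc t)) s′≥0) }
  ; *∈   = λ { {p} {r} (t , s , tp≋s , s≥0) (t′ , s′ , tr≋s′ , s′≥0) →
      t′ ℕ.+ t ℕ.* suc t′ , s ⊗ s′
    , ≋-trans (Poly.*-congʳ {p ⊗ r} (scalar-* t t′))
        (≋-trans (solve 4 (λ t t′ p r → t :* t′ :* (p :* r) := (t :* p) :* (t′ :* r)) ≋-refl
                    (ι (+ suc t)) (ι (+ suc t′)) p r)
                 (Poly.*-cong tp≋s tr≋s′))
    , good-⊗ s≥0 s′≥0 }
  }
  where
  scalar-* : ∀ t t′ → ι (+ suc (t′ ℕ.+ t ℕ.* suc t′)) ≋ ι (+ suc t) ⊗ ι (+ suc t′)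
  scalar-* t t′ = ≋-trans (≡⇒≋ (cong ι (ℤ.pos-* (suc t) (suc t′)))) (ι-* (+ suc t) (+ suc t′))

-- The 2 is absorbed into the denominator, `suc t` becoming `suc t * 2`, while the list of good
-- terms is kept.
2-cancellable : Cancellable positive-isCone (𝟙 ⊕ 𝟙)
2-cancellable {p} (t , s , t2p≋s , s≥0) = 1 ℕ.+ t ℕ.* 2 , s
  , ≋-trans (Poly.*-congʳ {p} (≡⇒≋ (cong ι (ℤ.pos-* (suc t) 2))))
      (≋-trans (≡⇒≋ (⊗-assoc (ι (+ suc t)) (ι (+ 2)) p))
        (≋-trans (Poly.*-congˡ {ι (+ suc t)} (Poly.*-congʳ {p} (ι-+ 1ℤ 1ℤ))) t2p≋s))
  , s≥0

-- A positive integer factor changes neither the signs of the coefficients nor the set of monomials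
-- that occur.
positive⇒nonNeg : ∀ {p} → Positive p → NonNeg p
positive⇒nonNeg {p} (t , r , tp≋r , r≥0) = coeff≥0 , exponent≥0
  where
  scaled : ∀ m → + suc t ℤ.* coeff p m ≡ coeff r m
  scaled m = trans (cong (λ k → + suc t ℤ.* coeff p k) (sym (zeroMon⁻· m)))
    (trans (sym (coeff-single-⊗ (+ suc t) zeroMon p m)) (at tp≋r m))
    where
    zeroMon⁻· : ∀ m → zeroMon ⁻· m ≡ m
    zeroMon⁻· m = trans (sym (·-identityˡ (zeroMon ⁻· m))) (·-⁻· zeroMon m)
  good-coeff : ∀ {r} → All GoodTerm r → ∀ m → 0ℤ ℤ.≤ coeff r m
  good-coeff [] m = ℤ.≤-refl
  good-coeff {(c , n) ∷ r} ((c≥0 , _) ∷ r≥0) m with n ≟ₘ m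
  ... | yes _ = 0≤+ c≥0 (good-coeff r≥0 m)
  ... | no _  = good-coeff r≥0 m
  good-exponent : ∀ {r} → All GoodTerm r → ∀ m → ¬ coeff r m ≡ 0ℤ → ∀ i → ¬ i ≡ 1F → 0ℤ ℤ.≤ lookup m i
  good-exponent [] m ≢0 = contradiction refl ≢0
  good-exponent {(c , n) ∷ r} ((_ , n≥0) ∷ r≥0) m ≢0 with n ≟ₘ m
  ... | yes refl = n≥0
  ... | no _     = good-exponent r≥0 m ≢0
  coeff≥0 : ∀ m → 0ℤ ℤ.≤ coeff p m
  coeff≥0 m = ℤ.*-cancelˡ-≤-pos 0ℤ (coeff p m) (+ suc t)
    (ℤ.≤-trans (ℤ.≤-reflexive (ℤ.*-zeroʳ (+ suc t))) (subst (0ℤ ℤ.≤_) (sym (scaled m)) (good-coeff r≥0 m)))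
  exponent≥0 : ∀ m → ¬ coeff p m ≡ 0ℤ → ∀ i → ¬ i ≡ 1F → 0ℤ ℤ.≤ lookup m i
  exponent≥0 m ≢0 = good-exponent r≥0 m λ r≡0 → ≢0
    (ℤ.*-cancelˡ-≡ (+ suc t) (coeff p m) 0ℤ (trans (scaled m) (trans r≡0 (sym (ℤ.*-zeroʳ (+ suc t))))))

setting : Setting positive-isCone θ-isDerivation
setting = record
  { a₀ = a₀ ; a₁ = a₁ ; a₂ = a₂ ; b₀ = b₀ ; b₁ = b₁ ; b₂ = b₂ ; q = q ; a₁⁻¹ = a₁⁻¹ ; ι = ι
  ; a₀∈   = X∈ 0F
  ; a₁∈   = X∈ 1F
  ; a₂∈   = X∈ 2F
  ; b₀∈   = X∈ 3F
  ; b₁∈   = X∈ 4F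
  ; b₂∈   = X∈ 5F
  ; q∈    = X∈ 6F
  ; a₁⁻¹∈ = good⇒positive a₁⁻¹ ((ℤ.+≤+ z≤n , λ
      { 0F _ → ℤ.≤-refl ; 1F i≢1 → contradiction refl i≢1 ; 2F _ → ℤ.≤-refl ; 3F _ → ℤ.≤-refl
      ; 4F _ → ℤ.≤-refl ; 5F _ → ℤ.≤-refl ; 6F _ → ℤ.≤-refl }) ∷ [])
  -- θ multiplies the single term by its exponent of q, which is 0; the result is a term with
  -- coefficient 0 and not the empty list.
  ; a₀-constant   = zero-coefficient _
  ; a₁-constant   = zero-coefficient _
  ; a₂-constant   = zero-coefficient _
  ; b₀-constant   = zero-coefficient _
  ; b₁-constant   = zero-coefficient _
  ; b₂-constant   = zero-coefficient _
  ; a₁⁻¹-constant = zero-coefficient _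
  ; θq       = ≋-refl
  ; a₁*a₁⁻¹  = ≋-refl
  ; 2-cancel = 2-cancellable
  ; ι-+      = ι-+
  ; ι-*      = ι-*
  ; ι-neg    = λ _ → ≋-refl
  ; ι-ℕ      = ι-ℕ
  }
  where
  zero-coefficient : ∀ m → [ (0ℤ , m) ] ≋ 𝟘
  zero-coefficient m = pointwise go
    where
    go : [ (0ℤ , m) ] ≈ 𝟘
    go k with m ≟ₘ k
    ... | yes _ = refl
    ... | no _  = refl
  X∈ : ∀ i → Positive (X i)
  X∈ i = good⇒positive (X i) ((ℤ.+≤+ z≤n , λ j _ →
    subst (0ℤ ℤ.≤_) (sym (lookup∘tabulate (λ j → if ⌊ i Fin.≟ j ⌋ then 1ℤ else 0ℤ) j)) (indicator≥0 ⌊ i Fin.≟ j ⌋)) ∷ [])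
    where
    indicator≥0 : ∀ b → 0ℤ ℤ.≤ (if b then 1ℤ else 0ℤ)
    indicator≥0 true  = ℤ.+≤+ z≤n
    indicator≥0 false = ℤ.≤-refl

-- Comparison of the two determinants.

neg-sumᵖ : ∀ {n} (w : Fin n → Poly) → neg (sumᵖ (tabulate (neg ∘ w))) ≋ sumᵖ (tabulate w)
neg-sumᵖ {zero}  w = ≋-refl
neg-sumᵖ {suc n} w = ≋-trans
  (solve 2 (λ x y → :- (:- x :+ y) := x :+ :- y) ≋-refl (w zero) (sumᵖ (tabulate (neg ∘ w ∘ suc))))
  (⊕-cong ≋-refl (neg-sumᵖ (w ∘ suc)))

-- `det` has explicit signs, `alternatingSum` nested negations. The summands are an arbitrary family
-- `w`, so that the induction can continue with `neg ∘ w ∘ suc` and absorb one sign at each column.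
alternatingSum-tabulate : ∀ {n} φ (c : Fin (suc n) → Column) (w : Fin (suc n) → Poly) →
  (∀ j → w j ≋ ι (sign (Fin.toℕ j)) ⊗ φ (c j) (tabulate (c ∘ Fin.punchIn j))) →
  alternatingSum φ (tabulate c) ≋ sumᵖ (tabulate w)
alternatingSum-tabulate {zero} φ c w w≋ = ⊕-cong (≋-sym (≋-trans (w≋ zero) (Poly.*-identityˡ _))) ≋-refl
alternatingSum-tabulate {suc n} φ c w w≋ = ⊕-cong
  (≋-sym (≋-trans (w≋ zero) (Poly.*-identityˡ _)))
  (≋-trans (Poly.-‿cong (alternatingSum-tabulate (λ c′ cs → φ c′ (c zero ∷ cs)) (c ∘ suc) (neg ∘ w ∘ suc)
             (λ j → ≋-trans (Poly.-‿cong (w≋ (suc j)))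
               (solve 2 (λ s x → :- (:- s :* x) := s :* x) ≋-refl (ι (sign (Fin.toℕ j))) _))))
           (neg-sumᵖ (w ∘ suc)))

sumᵖ-tabulate-cong : ∀ {n} {v w : Fin n → Poly} → (∀ j → v j ≋ w j) → sumᵖ (tabulate v) ≋ sumᵖ (tabulate w)
sumᵖ-tabulate-cong {zero}  v≋w = ≋-refl
sumᵖ-tabulate-cong {suc n} v≋w = ⊕-cong (v≋w zero) (sumᵖ-tabulate-cong (v≋w ∘ suc))

det≋minor : ∀ r (row : Fin r → ℕ) (column : Fin r → Column) →
  det r (λ i j → column j (row i)) ≋ minor (tabulate row) (tabulate column)
det≋minor zero    row column = ≋-refl
det≋minor (suc r) row column = ≋-trans
  (≡⇒≋ (cong sumᵖ (map-tabulate id (λ j → ι (sign (Fin.toℕ j)) ⊗ column j (row zero)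
     ⊗ det r (λ i k → column (Fin.punchIn j k) (row (suc i)))))))
  (≋-sym (alternatingSum-tabulate (λ c cs → c (row zero) ⊗ minor (tabulate (row ∘ suc)) cs) column _
    (λ j → ≋-trans (Poly.*-congˡ {ι (sign (Fin.toℕ j)) ⊗ column j (row zero)} (det≋minor r (row ∘ suc) (column ∘ Fin.punchIn j)))
      (≡⇒≋ (⊗-assoc (ι (sign (Fin.toℕ j))) (column j (row zero)) _)))))

tabulate-strict : ∀ {r l} (f : Fin r → ℕ) → StrictlyIncreasing f → (∀ i → l ℕ.≤ f i) → Strict l (tabulate f)
tabulate-strict {zero}  f f< l≤f = []
tabulate-strict {suc r} f f< l≤f = l≤f zero ∷
  tabulate-strict (f ∘ suc) (λ i j i<j → f< (suc i) (suc j) (s≤s i<j)) (λ i → f< zero (suc i) (s≤s z≤n))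

-- Row polynomials and the conclusion.

^ᵖ≡^ : ∀ p k → p ^ᵖ k ≡ p ^ k
^ᵖ≡^ p zero    = refl
^ᵖ≡^ p (suc k) = cong (p ⊗_) (^ᵖ≡^ p k)

sumᵖ≡∑ : ∀ {f g : ℕ → Poly} → (∀ k → f k ≡ g k) → ∀ n e → sumᵖ (map f (applyUpTo e n)) ≡ ∑ n (g ∘ e)
sumᵖ≡∑ f≡g zero    e = refl
sumᵖ≡∑ f≡g (suc n) e = cong₂ _⊕_ (f≡g (e 0)) (sumᵖ≡∑ f≡g n (e ∘ suc))

rowPoly≡rowSum : ∀ T n → rowPoly T n ≡ rowSum q T n
rowPoly≡rowSum T n = sumᵖ≡∑ {λ k → T n k ⊗ (q ^ᵖ k)} {λ k → T n k ⊗ (q ^ k)}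
  (λ k → cong (T n k ⊗_) (^ᵖ≡^ q k)) (suc n) id

rowSum-positive : ∀ {T} → Triangular T → OneOfRecurrences T → HankelPositive positive-isCone (rowSum q T)
rowSum-positive {T} (T₀₀ , T₀) = λ
  { (inj₁ rec)                                                          → hankelPositiveᵢ setting triangle (recursion Aᵢ Bᵢ rec)
  ; (inj₂ (inj₁ rec))                                                   → hankelPositiveᵢᵢ setting triangle (recursion Aᵢᵢ Bᵢᵢ rec)
  ; (inj₂ (inj₂ (inj₁ rec)))                                            → hankelPositiveᵢᵢᵢ setting triangle (recursion Aᵢᵢᵢ Bᵢᵢᵢ rec)
  ; (inj₂ (inj₂ (inj₂ (inj₁ rec))))                                     → hankelPositiveᵢᵥ setting triangle (recursion Aᵢᵥ Bᵢᵥ rec)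
  ; (inj₂ (inj₂ (inj₂ (inj₂ (inj₁ rec)))))                              → hankelPositiveᵥ₁ setting triangle (recursion (Aᵥ 𝟘) (Bᵥ b₂) rec)
  ; (inj₂ (inj₂ (inj₂ (inj₂ (inj₂ (inj₁ rec))))))                       → hankelPositiveᵥ₂ setting triangle (recursion (Aᵥ a₂) (Bᵥ 𝟘) rec)
  ; (inj₂ (inj₂ (inj₂ (inj₂ (inj₂ (inj₂ (inj₁ rec)))))))                → hankelPositiveᵥ₃ setting triangle (recursion (Aᵥ a₁) (Bᵥ b₂) rec)
  ; (inj₂ (inj₂ (inj₂ (inj₂ (inj₂ (inj₂ (inj₂ (inj₁ rec))))))))         → hankelPositiveᵥ₄ setting triangle (recursion (Aᵥ a₂) (Bᵥ b₀) rec)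
  ; (inj₂ (inj₂ (inj₂ (inj₂ (inj₂ (inj₂ (inj₂ (inj₂ (inj₁ rec)))))))))  → hankelPositiveᵥᵢ setting triangle (recursion Aᵥᵢ Bᵥᵢ rec)
  ; (inj₂ (inj₂ (inj₂ (inj₂ (inj₂ (inj₂ (inj₂ (inj₂ (inj₂ rec)))))))))  → hankelPositiveᵥᵢᵢ setting triangle (recursion Aᵥᵢᵢ Bᵥᵢᵢ rec)
  }
  where
  open RowSums polyRing using (Recursion)
  triangle : Triangle T
  triangle = pointwise T₀₀ , λ n k n<k → pointwise (T₀ n k n<k)
  -- `Recurrence` evaluates its coefficients at the target entry and `Recursion` at the source
  -- entry, hence the shifts.
  recursion : ∀ A B → Recurrence A B T → Recursion (λ n k → A (suc n) k) (λ n k → B (suc n) (suc k)) T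
  recursion A B rec n = pointwise (proj₁ (rec n)) , λ k → pointwise (proj₂ (rec n) k)

theorem1p3 : (T : ℕ → ℕ → Poly) → Triangular T → OneOfRecurrences T →
    StieltjesMoment (rowPoly T) × LogConvex 3 (rowPoly T)
theorem1p3 T triangular oneOf = stieltjes , logConvex
  where
  hankel : HankelPositive positive-isCone (rowPoly T)
  hankel {rs} {js} rs< js< = IsCone.resp positive-isCone
    (form-map-cong (minor-isForm rs) {λ j i → rowSum q T (i ℕ.+ j)} {λ j i → rowPoly T (i ℕ.+ j)} (λ j i → ≡⇒≋ (sym (rowPoly≡rowSum T (i ℕ.+ j)))) js)
    (rowSum-positive {T} triangular oneOf rs< js<)
  stieltjes : StieltjesMoment (rowPoly T)
  stieltjes r rows cols rows< cols< = positive⇒nonNeg (IsCone.resp positive-isCone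
    (≋-sym (≋-trans (det≋minor r rows (λ j i → rowPoly T (i ℕ.+ cols j)))
      (≡⇒≋ (cong (minor (tabulate rows)) (sym (map-tabulate cols (λ j i → rowPoly T (i ℕ.+ j))))))))
    (hankel (tabulate-strict rows rows< (λ _ → z≤n)) (tabulate-strict cols cols< (λ _ → z≤n))))
  logConvex : LogConvex 3 (rowPoly T)
  logConvex 1 _ _ j = positive⇒nonNeg (L∈ positive-isCone (rowPoly T) hankel j)
  logConvex 2 _ _ j = positive⇒nonNeg (L²∈ positive-isCone (rowPoly T) hankel j)
  logConvex 3 _ _ j = positive⇒nonNeg (L³∈ positive-isCone (rowPoly T) hankel j)
  logConvex (suc (suc (suc (suc _)))) _ (s≤s (s≤s (s≤s ()))) j
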